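{- Let $\mu$ be a polynomial-time computable monotone function. Then for every fixed $q$, there is an $n^{O(q)}m$ time algorithm for the $(\mu,p,q)$-Partition problem, where $n$ and $m$ denote the number of vertices and edges of the input graph (and $p$ is part of the input).
   Context: Here $\mu$ assigns a nonnegative integer to each subset of vertices of a graph $G$; it is monotone if $\mu(X)\le\mu(Y)$ whenever $X\subseteq Y\subseteq V(G)$. For $X\subseteq V(G)$, $d(X)$ is the number of edges of the undirected graph $G$ between $X$ and $V(G)\setminus X$. A set $C\subseteq V(G)$ is a $(\mu,p,q)$-cluster if $\mu(C)\le p$ and $d(C)\le q$. A $(\mu,p,q)$-partition of $G$ is a partition of $V(G)$ into $(\mu,p,q)$-clusters. The $(\mu,p,q)$-Partition problem: given a graph $G$ and integers $p,q$, find a $(\mu,p,q)$-partition of $G$ (or report that none exists). -}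

module Defs where

open import Data.Bool using (Bool; true; false; T; T?)
open import Data.Fin using (Fin) renaming (_<_ to _<ᶠ_; _<?_ to _<ᶠ?_)
open import Data.Fin.Subset using (Subset; _∈_; _∉_; _⊆_; _∩_; Empty; Nonempty)
open import Data.Fin.Subset.Properties using (_∈?_)
open import Data.List using (List; []; _∷_; length; filter; allFin; cartesianProduct)
open import Data.List.Relation.Unary.All using (All)
open import Data.List.Relation.Unary.Any using (Any)
open import Data.List.Relation.Unary.AllPairs using (AllPairs)
open import Data.Maybe using (Maybe; just; nothing)
open import Data.Nat using (ℕ; suc; _+_; _*_; _^_; _≤_)
open import Data.Nat.Binary using (ℕᵇ; 2[1+_]; 1+[2_]; fromℕ) renaming (zero to 0ᵇ)
open import Data.Product using (Σ; ∃; ∃₂; _×_; _,_)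
open import Data.Sum using (_⊎_)
open import Data.Vec using (tabulate; toList)
open import Relation.Binary.PropositionalEquality using (_≡_)
open import Relation.Nullary using (¬_; ¬?; Dec)
open import Relation.Nullary.Decidable using (_×-dec_; _⊎-dec_)

-- Finite simple undirected graphs with vertex set Fin n.
record Graph (n : ℕ) : Set where
  field
    adj       : Fin n → Fin n → Bool
    symmetric : ∀ u v → adj u v ≡ adj v u
    loopless  : ∀ v → adj v v ≡ false

open Graph public

-- Each edge {u , v} is listed once, as the pair with u < v.
edges : ∀ {n} → Graph n → List (Fin n × Fin n)
edges {n} G = filter (λ (u , v) → (u <ᶠ? v) ×-dec T? (adj G u v))
                     (cartesianProduct (allFin n) (allFin n))

#edges : ∀ {n} → Graph n → ℕ
#edges G = length (edges G)

Crosses : ∀ {n} → Subset n → Fin n × Fin n → Set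
Crosses X (u , v) = (u ∈ X × v ∉ X) ⊎ (u ∉ X × v ∈ X)

crosses? : ∀ {n} (X : Subset n) (e : Fin n × Fin n) → Dec (Crosses X e)
crosses? X (u , v) = ((u ∈? X) ×-dec ¬? (v ∈? X)) ⊎-dec (¬? (u ∈? X) ×-dec (v ∈? X))

d : ∀ {n} → Graph n → Subset n → ℕ
d G X = length (filter (crosses? X) (edges G))

SetFunction : Set
SetFunction = ∀ {n} → Graph n → Subset n → ℕ

Monotone : SetFunction → Set
Monotone μ = ∀ {n} (G : Graph n) {X Y : Subset n} → X ⊆ Y → μ G X ≤ μ G Y

IsCluster : SetFunction → ℕ → ℕ → ∀ {n} → Graph n → Subset n → Set
IsCluster μ p q G C = μ G C ≤ p × d G C ≤ q

record IsPartition {n : ℕ} (Cs : List (Subset n)) : Set where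
  field
    nonempty : All Nonempty Cs
    disjoint : AllPairs (λ C D → Empty (C ∩ D)) Cs
    covering : ∀ v → Any (v ∈_) Cs

IsClusterPartition : SetFunction → ℕ → ℕ → ∀ {n} → Graph n → List (Subset n) → Set
IsClusterPartition μ p q G Cs = IsPartition Cs × All (IsCluster μ p q G) Cs

-- The value nothing reports that no partition exists.
Solves : SetFunction → ℕ → ℕ → ∀ {n} → Graph n → Maybe (List (Subset n)) → Set
Solves μ p q G (just Cs) = IsClusterPartition μ p q G Cs
Solves μ p q G nothing   = ¬ ∃ (IsClusterPartition μ p q G)

-- The machine model is a point-free form of Jones' WHILE language (N. D. Jones,
-- Computability and Complexity, 1997): a program transforms one binary tree, and
-- every basic operation has unit cost.  Trees are thought of as pointers to shared
-- cells, so that copying a tree is a unit-cost operation too; the model is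
-- polynomially equivalent to Turing machines and random access machines.
infixr 5 _∙_

data Tree : Set where
  nil : Tree
  _∙_ : Tree → Tree → Tree

size : Tree → ℕ
size nil     = 1
size (x ∙ y) = suc (size x + size y)

infixr 4 _⨾_
infix  4 if_then_else_

data Program : Set where
  skip mknil hd tl : Program
  cons             : Program → Program → Program
  _⨾_              : Program → Program → Program
  if_then_else_    : Program → Program → Program → Program
  while_loop_      : Program → Program → Program

private
  variable
    P Q R         : Program
    x y z a b     : Tree
    s t r         : ℕ

-- P ⊢ x ⇒ y [ t ]: on input x, program P halts with output y after t steps.
-- As a test value, nil is false and every other tree is true.
infix 3 _⊢_⇒_[_]

data _⊢_⇒_[_] : Program → Tree → Tree → ℕ → Set where
  skip    : skip ⊢ x ⇒ x [ 1 ]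
  mknil   : mknil ⊢ x ⇒ nil [ 1 ]
  hd-nil  : hd ⊢ nil ⇒ nil [ 1 ]
  hd-∙    : hd ⊢ x ∙ y ⇒ x [ 1 ]
  tl-nil  : tl ⊢ nil ⇒ nil [ 1 ]
  tl-∙    : tl ⊢ x ∙ y ⇒ y [ 1 ]
  cons    : P ⊢ x ⇒ y [ s ] → Q ⊢ x ⇒ z [ t ] →
            cons P Q ⊢ x ⇒ y ∙ z [ suc (s + t) ]
  seq     : P ⊢ x ⇒ y [ s ] → Q ⊢ y ⇒ z [ t ] →
            P ⨾ Q ⊢ x ⇒ z [ suc (s + t) ]
  if-true : P ⊢ x ⇒ a ∙ b [ s ] → Q ⊢ x ⇒ y [ t ] →
            if P then Q else R ⊢ x ⇒ y [ suc (s + t) ]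
  if-false : P ⊢ x ⇒ nil [ s ] → R ⊢ x ⇒ y [ t ] →
             if P then Q else R ⊢ x ⇒ y [ suc (s + t) ]
  while-stop : P ⊢ x ⇒ nil [ s ] →
               while P loop Q ⊢ x ⇒ x [ suc s ]
  while-step : P ⊢ x ⇒ a ∙ b [ s ] → Q ⊢ x ⇒ y [ t ] →
               while P loop Q ⊢ y ⇒ z [ r ] →
               while P loop Q ⊢ x ⇒ z [ suc (s + t + r) ]

HaltsWithin : Program → Tree → Tree → ℕ → Set
HaltsWithin P x y b = ∃ λ t → (P ⊢ x ⇒ y [ t ]) × t ≤ b

encodeBool : Bool → Tree
encodeBool false = nil
encodeBool true  = nil ∙ nil

encodeList : ∀ {A : Set} → (A → Tree) → List A → Tree
encodeList enc []       = nil
encodeList enc (w ∷ ws) = enc w ∙ encodeList enc ws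

encodeMaybe : ∀ {A : Set} → (A → Tree) → Maybe A → Tree
encodeMaybe enc nothing  = nil
encodeMaybe enc (just w) = enc w ∙ nil

-- Numbers are written in (bijective) binary, least significant digit first.
encodeℕᵇ : ℕᵇ → Tree
encodeℕᵇ 0ᵇ       = nil
encodeℕᵇ 1+[2 k ] = encodeBool false ∙ encodeℕᵇ k
encodeℕᵇ 2[1+ k ] = encodeBool true  ∙ encodeℕᵇ k

encodeℕ : ℕ → Tree
encodeℕ k = encodeℕᵇ (fromℕ k)

encodeSubset : ∀ {n} → Subset n → Tree
encodeSubset X = encodeList encodeBool (toList X)

-- The adjacency matrix, as a list of rows.
encodeGraph : ∀ {n} → Graph n → Tree
encodeGraph G =
  encodeList encodeSubset (toList (tabulate λ u → tabulate λ v → adj G u v))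

encodeAnswer : ∀ {n} → Maybe (List (Subset n)) → Tree
encodeAnswer = encodeMaybe (encodeList encodeSubset)

PolynomialTime : SetFunction → Set
PolynomialTime μ =
  Σ Program λ M → ∃₂ λ c k → ∀ {n} (G : Graph n) (X : Subset n) →
    let input = encodeGraph G ∙ encodeSubset X in
    HaltsWithin M input (encodeℕ (μ G X)) (c * size input ^ k)

-- f q = O(q) as q → ∞.
IsLinear : (ℕ → ℕ) → Set
IsLinear f = ∃₂ λ c q₀ → ∀ q → q₀ ≤ q → f q ≤ c * q

-- A solves the partition problem for the fixed value q (p is part of the input)
-- in time B n m on every graph with n vertices and m edges.
SolvesInTime : SetFunction → ℕ → Program → (ℕ → ℕ → ℕ) → Set
SolvesInTime μ q A B =
  ∀ {n} (G : Graph n) (p : ℕ) → ∃ λ answer →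
    HaltsWithin A (encodeGraph G ∙ encodeℕ p) (encodeAnswer answer) (B n (#edges G))
    × Solves μ p q G answer

{-# OPTIONS --safe #-}
module Submission where

-- A vertex v of a cluster C lies in a component X of G minus the boundary of C; since
-- X ⊆ C and every edge leaving X is in the boundary of C, X is a cluster as well.  So
-- trying all sets of at most q pairs of vertices finds, for every v, a cluster around v
-- if there is one.  If every vertex has such a cluster, then these clusters form a cover,
-- which is made disjoint pair by pair: by posimodularity,
-- d(X ∖ Y) + d(Y ∖ X) ≤ d(X) + d(Y) ≤ 2q, so X ∖ Y can replace X or Y ∖ X can replace Y.
--
-- The running time is controlled through a small typed language whose only loops run
-- over the n vertices.  The degree of an expression bounds its running time by
-- (2 ⊔ n) ^ degree, and the degree of the algorithm is affine in q because guessing one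
-- more pair adds a constant.

open import Defs
open import Data.Bool using (Bool; true; false; T; T?; _∧_; _xor_)
  renaming (if_then_else_ to ifᵇ_then_else_)
open import Data.Empty using (⊥; ⊥-elim)
open import Data.Fin using (Fin; zero; suc; toℕ) renaming (_<?_ to _<ᶠ?_)
open import Data.Fin.Properties using (toℕ<n; toℕ-injective)
open import Data.Fin.Subset using (Subset; ∣_∣; Nonempty)
  renaming (_∈_ to _∈ˢ_; _⊆_ to _⊆ˢ_)
open import Data.Fin.Subset.Properties
  using (_∈?_; drop-∷-⊆; ∣p∣≤n; x∈p∩q⁻; ∣⁅x⁆∣≡1; x∈⁅y⁆⇒x≡y; p⊆q⇒∣p∣≤∣q∣)
open import Data.List using (List; []; _∷_; _++_; allFin; applyUpTo; cartesianProduct; downFrom;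
  filter; foldl; foldr; length; map; replicate; reverse; upTo)
import Data.List as List
open import Data.List.Membership.Propositional using (_∈_; _∉_; find)
open import Data.List.Membership.Propositional.Properties
  using (∈-allFin; ∈-filter⁺; ∈-filter⁻; ∈-cartesianProduct⁺; ∈-++⁺ˡ; ∈-++⁻)
open import Data.List.Properties using (length-++; length-replicate; length-reverse;
  length-tabulate; map-tabulate; reverse-foldl; reverse-map; reverse-upTo)
open import Data.List.Relation.Unary.All using (All; []; _∷_)
import Data.List.Relation.Unary.All as All
import Data.List.Relation.Unary.All.Properties as All
open import Data.List.Relation.Unary.AllPairs using (AllPairs; []; _∷_)
open import Data.List.Relation.Unary.AllPairs.Properties using (tabulate⁺-<)
open import Data.List.Relation.Unary.Any using (Any; here; there)
open import Data.Maybe using (Maybe; just; nothing)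
open import Data.Nat
open import Data.Nat.Binary using (ℕᵇ; 1+[2_]; 2[1+_]; fromℕ;
  0<even; 0<odd; even<even; even<odd; odd<even; odd<odd) renaming (zero to 0ᵇ)
import Data.Nat.Binary as B
import Data.Nat.Binary.Properties as B
open import Data.Nat.Properties
open import Data.Nat.Tactic.RingSolver using (solve-∀)
open import Data.Product using (Σ; ∃; _×_; _,_; proj₁; proj₂)
open import Data.Sum using (_⊎_; inj₁; inj₂; [_,_]′)
open import Data.Unit using (⊤; tt)
open import Data.Vec using (Vec; []; _∷_; here; lookup; tabulate; toList)
open import Data.Vec.Properties using (lookup∘tabulate; []=⇒lookup; lookup⇒[]=)
open import Function using (_∘_; id)
open import Relation.Binary.Definitions using (tri<; tri≈; tri>)
open import Relation.Binary.PropositionalEquality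
open import Relation.Nullary using (¬_; Dec; yes; contradiction; does)
open import Relation.Nullary.Decidable using (dec-true; dec-false; _×-dec_)
open import Relation.Unary using (Decidable)

-- A typed language with polynomial running time

-- The bound must not depend on `p`, although `p` is part of the input and may have any number of
-- digits. Copying `p` is a unit-cost operation, so only the test `μ G X ≤ p` is at stake. It reads
-- the digits of both numbers in parallel and stops as soon as either runs out, so the digits of
-- `μ G X` limit it. Their number is polynomial because a program that runs for t steps adds at most
-- t to the height of its tree. Posimodularity is preferred to the union and intersection of
-- submodularity because a difference lies inside one of the original sets: monotonicity keeps `μ`
-- at most `p`, and what one set loses is still covered by the other. The powers have base `2 ⊔ n`
-- because a base of at least 2 absorbs constants and sums into the exponent.

true! : Program
true! = cons mknil mknil

encodeUnary : ℕ → Tree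
encodeUnary zero    = nil
encodeUnary (suc k) = nil ∙ encodeUnary k

data Ty : Set where
  bool index unary number graph : Ty
  vec list maybe                : Ty → Ty

⟦_⟧ᵀ : Ty → ℕ → Set
⟦ bool    ⟧ᵀ n = Bool
⟦ index   ⟧ᵀ n = Fin n
⟦ unary   ⟧ᵀ n = ℕ
⟦ number  ⟧ᵀ n = ℕ
⟦ graph   ⟧ᵀ n = Graph n
⟦ vec A   ⟧ᵀ n = Vec (⟦ A ⟧ᵀ n) n
⟦ list A  ⟧ᵀ n = List (⟦ A ⟧ᵀ n)
⟦ maybe A ⟧ᵀ n = Maybe (⟦ A ⟧ᵀ n)

encode : ∀ A {n} → ⟦ A ⟧ᵀ n → Tree
encode bool      b = encodeBool b
encode index     i = encodeUnary (toℕ i)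
encode unary     k = encodeUnary k
encode number    k = encodeℕ k
encode graph     G = encodeGraph G
encode (vec A)   v = encodeList (encode A) (toList v)
encode (list A)  l = encodeList (encode A) l
encode (maybe A) m = encodeMaybe (encode A) m

Ctx : Set
Ctx = List Ty

infix 4 _‵?_∶_

-- Loops exist only as `tab` and `iter`, with one round per vertex. `call` evaluates its body in a
-- context made of the arguments alone, so that subroutines can be reused anywhere without renaming.
-- Counts have type `unary`, where successor and zero test take constantly many steps; `number` is
-- reserved for `p`, which is only handed on to `within`.
data Exp (Γ : Ctx) : Ty → Set where
  var     : ∀ {A} → A ∈ Γ → Exp Γ A
  ‵let    : ∀ {A B} → Exp Γ A → Exp (A ∷ Γ) B → Exp Γ B
  call    : ∀ {A Δ} → All (Exp Γ) Δ → Exp Δ A → Exp Γ A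
  ‵true ‵false : Exp Γ bool
  _‵?_∶_  : ∀ {A} → Exp Γ bool → Exp Γ A → Exp Γ A → Exp Γ A
  less    : Exp Γ index → Exp Γ index → Exp Γ bool
  at      : ∀ {A} → Exp Γ (vec A) → Exp Γ index → Exp Γ A
  tab     : ∀ {A} → Exp (index ∷ Γ) A → Exp Γ (vec A)
  iter    : ∀ {A} → Exp Γ A → Exp (A ∷ index ∷ Γ) A → Exp Γ A
  ‵zero   : Exp Γ unary
  ‵suc ‵pred : Exp Γ unary → Exp Γ unary
  isZero  : Exp Γ unary → Exp Γ bool
  ‵[]     : ∀ {A} → Exp Γ (list A)
  _‵∷_    : ∀ {A} → Exp Γ A → Exp Γ (list A) → Exp Γ (list A)
  ‵nothing : ∀ {A} → Exp Γ (maybe A)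
  ‵just   : ∀ {A} → Exp Γ A → Exp Γ (maybe A)
  rows    : Exp Γ graph → Exp Γ (vec (vec bool))
  within  : Exp Γ graph → Exp Γ (vec bool) → Exp Γ number → Exp Γ bool

Env : Ctx → ℕ → Set
Env Γ n = All (λ A → ⟦ A ⟧ᵀ n) Γ

adjacency : ∀ {n} → Graph n → Vec (Vec Bool n) n
adjacency G = tabulate λ u → tabulate λ v → adj G u v

-- The environment ends with the list of all indices in descending order: a loop
-- that consumes it computes a foldr over the ascending list, and a loop that
-- conses results along it builds a vector in the right order.
indices : ℕ → Tree
indices n = encodeList (encode index) (reverse (allFin n))

encodeEnv : ∀ {Γ n} → Env Γ n → Tree
encodeEnv {n = n} []      = indices n
encodeEnv {A ∷ _} (x ∷ γ) = encode A x ∙ encodeEnv γ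

module Semantics (μ : SetFunction) where

  mutual
    ⟦_⟧ : ∀ {Γ A} → Exp Γ A → ∀ {n} → Env Γ n → ⟦ A ⟧ᵀ n
    ⟦ var x ⟧        γ = All.lookup γ x
    ⟦ ‵let e b ⟧     γ = ⟦ b ⟧ (⟦ e ⟧ γ ∷ γ)
    ⟦ call as e ⟧    γ = ⟦ e ⟧ (⟦ as ⟧* γ)
    ⟦ ‵true ⟧        γ = true
    ⟦ ‵false ⟧       γ = false
    ⟦ c ‵? e ∶ f ⟧   γ = ifᵇ ⟦ c ⟧ γ then ⟦ e ⟧ γ else ⟦ f ⟧ γ
    ⟦ less e f ⟧     γ = toℕ (⟦ e ⟧ γ) <ᵇ toℕ (⟦ f ⟧ γ)
    ⟦ at e f ⟧       γ = lookup (⟦ e ⟧ γ) (⟦ f ⟧ γ)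
    ⟦ tab e ⟧        γ = tabulate λ i → ⟦ e ⟧ (i ∷ γ)
    ⟦ iter e b ⟧ {n} γ = foldr (λ i a → ⟦ b ⟧ (a ∷ i ∷ γ)) (⟦ e ⟧ γ) (allFin n)
    ⟦ ‵zero ⟧        γ = 0
    ⟦ ‵suc e ⟧       γ = suc (⟦ e ⟧ γ)
    ⟦ ‵pred e ⟧      γ = pred (⟦ e ⟧ γ)
    ⟦ isZero e ⟧     γ = ⟦ e ⟧ γ ≡ᵇ 0
    ⟦ ‵[] ⟧          γ = []
    ⟦ e ‵∷ f ⟧       γ = ⟦ e ⟧ γ ∷ ⟦ f ⟧ γ
    ⟦ ‵nothing ⟧     γ = nothing
    ⟦ ‵just e ⟧      γ = just (⟦ e ⟧ γ)
    ⟦ rows e ⟧       γ = adjacency (⟦ e ⟧ γ)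
    ⟦ within e f g ⟧ γ = does (μ (⟦ e ⟧ γ) (⟦ f ⟧ γ) ≤? ⟦ g ⟧ γ)

    ⟦_⟧* : ∀ {Γ Δ} → All (Exp Γ) Δ → ∀ {n} → Env Γ n → Env Δ n
    ⟦ [] ⟧*     γ = []
    ⟦ e ∷ es ⟧* γ = ⟦ e ⟧ γ ∷ ⟦ es ⟧* γ

-- Translation of expressions into tree programs, and their degrees

varP : ∀ {Γ} {A : Ty} → A ∈ Γ → Program
varP (here _)  = hd
varP (there x) = tl ⨾ varP x

indicesP : Ctx → Program
indicesP []      = skip
indicesP (A ∷ Γ) = tl ⨾ indicesP Γ

lessP : Program
lessP = (while if hd then tl else mknil loop cons (hd ⨾ tl) (tl ⨾ tl)) ⨾ if tl then true! else mknil

atP : Program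
atP = (while tl loop cons (hd ⨾ tl) (tl ⨾ tl)) ⨾ hd ⨾ hd

-- The state of the loop is (remaining indices ∙ accumulator) ∙ environment.
loopBody : Program → Program
loopBody step = cons (cons (hd ⨾ hd ⨾ tl) (cons (hd ⨾ tl) (cons (hd ⨾ hd ⨾ hd) tl) ⨾ step)) tl

loopP : Program → Program → Program → Program
loopP ixs init step =
  cons (cons ixs init) skip ⨾ (while hd ⨾ hd loop loopBody step) ⨾ hd ⨾ tl

module Compiler (test : Program) (testDegree : ℕ) where

  mutual
    compile : ∀ {Γ A} → Exp Γ A → Program
    compile (var x)        = varP x
    compile (‵let e b)     = cons (compile e) skip ⨾ compile b
    compile (call as e)    = compile* as ⨾ compile e
    compile ‵true          = true!
    compile ‵false         = mknil
    compile (c ‵? e ∶ f)   = if compile c then compile e else compile f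
    compile (less e f)     = cons (compile e) (compile f) ⨾ lessP
    compile (at e f)       = cons (compile e) (compile f) ⨾ atP
    compile {Γ} (tab e)    = loopP (indicesP Γ) mknil (cons (tl ⨾ compile e) hd)
    compile {Γ} (iter e b) = loopP (indicesP Γ) (compile e) (compile b)
    compile ‵zero          = mknil
    compile (‵suc e)       = cons mknil (compile e)
    compile (‵pred e)      = compile e ⨾ tl
    compile (isZero e)     = if compile e then mknil else true!
    compile ‵[]            = mknil
    compile (e ‵∷ f)       = cons (compile e) (compile f)
    compile ‵nothing       = mknil
    compile (‵just e)      = cons (compile e) mknil
    compile (rows e)       = compile e
    compile (within e f g) = cons (compile e) (cons (compile f) (compile g)) ⨾ test

    compile* : ∀ {Γ Δ} → All (Exp Γ) Δ → Program
    compile* {Γ} []   = indicesP Γ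
    compile* (e ∷ es) = cons (compile e) (compile* es)

  varDegree : ∀ {Γ} {A : Ty} → A ∈ Γ → ℕ
  varDegree (here _)  = 0
  varDegree (there x) = 2 + varDegree x

  indicesDegree : Ctx → ℕ
  indicesDegree []      = 0
  indicesDegree (A ∷ Γ) = 2 + indicesDegree Γ

  -- The summand of a subexpression that recurses comes last, so that the degree
  -- of a nested expression reduces to a numeral plus the degree of its core.
  mutual
    degree : ∀ {Γ A} → Exp Γ A → ℕ
    degree (var x)        = varDegree x
    degree (‵let e b)     = 4 + (degree e + degree b)
    degree (call as e)    = 2 + (degree* as + degree e)
    degree ‵true          = 2
    degree ‵false         = 0
    degree (c ‵? e ∶ f)   = 2 + (degree c + (degree e + degree f))
    degree (less e f)     = 4 + (degree e + degree f + 18)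
    degree (at e f)       = 4 + (degree e + degree f + 14)
    degree {Γ} (tab e)    = 40 + (indicesDegree Γ + degree e)
    degree {Γ} (iter e b) = 36 + (indicesDegree Γ + (degree e + degree b))
    degree ‵zero          = 0
    degree (‵suc e)       = 2 + degree e
    degree (‵pred e)      = 2 + degree e
    degree (isZero e)     = 4 + degree e
    degree ‵[]            = 0
    degree (e ‵∷ f)       = 2 + (degree e + degree f)
    degree ‵nothing       = 0
    degree (‵just e)      = 2 + degree e
    degree (rows e)       = degree e
    degree (within e f g) = 6 + (testDegree + (degree e + (degree f + degree g)))

    degree* : ∀ {Γ Δ} → All (Exp Γ) Δ → ℕ
    degree* {Γ} []   = indicesDegree Γ
    degree* (e ∷ es) = 2 + (degree e + degree* es)

-- A calculus of running times as exponents

module Timing (N : ℕ) (2≤N : 2 ≤ N) where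

  infix 4 _≼_

  _≼_ : ℕ → ℕ → Set
  t ≼ a = t ≤ N ^ a

  instance
    N≢0 : NonZero N
    N≢0 = >-nonZero (≤-trans (s≤s z≤n) 2≤N)

  ≼-weaken : ∀ {t a b} → a ≤ b → t ≼ a → t ≼ b
  ≼-weaken a≤b t≼a = ≤-trans t≼a (^-monoʳ-≤ N a≤b)

  1≼ : ∀ a → 1 ≼ a
  1≼ a = ≼-weaken (z≤n {a}) (≤-refl {1})

  -- Both terms are at most `N ^ (a + b)`, and `N ≥ 2` pays for the doubling. Adding exponents
  -- instead of taking their maximum is wasteful, but it makes every degree a sum over
  -- subexpressions, which stays affine in `q`.
  +-≼ : ∀ {s t a b} → s ≼ a → t ≼ b → s + t ≼ suc (a + b)
  +-≼ {s} {t} {a} {b} s≼a t≼b = begin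
    s + t                      ≤⟨ +-mono-≤ (≼-weaken (m≤m+n a b) s≼a) (≼-weaken (m≤n+m b a) t≼b) ⟩
    N ^ (a + b) + N ^ (a + b)  ≡⟨ cong (N ^ (a + b) +_) (sym (+-identityʳ _)) ⟩
    2 * N ^ (a + b)            ≤⟨ *-monoˡ-≤ _ 2≤N ⟩
    N ^ suc (a + b)            ∎
    where open ≤-Reasoning

  suc-+-≼ : ∀ {s t a b} → s ≼ a → t ≼ b → suc (s + t) ≼ 2 + (a + b)
  suc-+-≼ {a = a} {b} s≼a t≼b = +-≼ {a = 0} {suc (a + b)} (1≼ 0) (+-≼ {a = a} {b} s≼a t≼b)

  *-≼ : ∀ {s t a b} → s ≼ a → t ≼ b → s * t ≼ a + b
  *-≼ {a = a} {b} s≼a t≼b = ≤-trans (*-mono-≤ s≼a t≼b) (≤-reflexive (sym (^-distribˡ-+-* N a b)))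

  const-≼ : ∀ k → k ≼ k
  const-≼ zero    = z≤n
  const-≼ (suc k) = +-≼ {a = 0} {b = k} (1≼ 0) (const-≼ k)

  infix 3 _⊢_↦_⟨_⟩

  -- A record rather than an abbreviation, so that unification can read `a` off the type; it could
  -- not be recovered from `N ^ a`.
  record _⊢_↦_⟨_⟩ (P : Program) (x y : Tree) (a : ℕ) : Set where
    constructor by
    field halts : HaltsWithin P x y (N ^ a)

  open _⊢_↦_⟨_⟩ public

  weaken : ∀ {P x y a b} → a ≤ b → P ⊢ x ↦ y ⟨ a ⟩ → P ⊢ x ↦ y ⟨ b ⟩
  weaken a≤b (by (t , run , t≤)) = by (t , run , ≼-weaken a≤b t≤)

  skip′ : ∀ {x} → skip ⊢ x ↦ x ⟨ 0 ⟩
  skip′ = by (1 , skip , ≤-refl)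

  mknil′ : ∀ {x} → mknil ⊢ x ↦ nil ⟨ 0 ⟩
  mknil′ = by (1 , mknil , ≤-refl)

  hd′ : ∀ {x y} → hd ⊢ x ∙ y ↦ x ⟨ 0 ⟩
  hd′ = by (1 , hd-∙ , ≤-refl)

  tl′ : ∀ {x y} → tl ⊢ x ∙ y ↦ y ⟨ 0 ⟩
  tl′ = by (1 , tl-∙ , ≤-refl)

  tl-nil′ : tl ⊢ nil ↦ nil ⟨ 0 ⟩
  tl-nil′ = by (1 , tl-nil , ≤-refl)

  infixr 5 _∙′_
  infixr 4 _⨾′_

  _∙′_ : ∀ {P Q x y z a b} → P ⊢ x ↦ y ⟨ a ⟩ → Q ⊢ x ↦ z ⟨ b ⟩ → cons P Q ⊢ x ↦ y ∙ z ⟨ 2 + (a + b) ⟩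
  _∙′_ {a = a} {b} (by (s , p , s≤)) (by (t , q , t≤)) = by (_ , cons p q , suc-+-≼ {a = a} {b} s≤ t≤)

  _⨾′_ : ∀ {P Q x y z a b} → P ⊢ x ↦ y ⟨ a ⟩ → Q ⊢ y ↦ z ⟨ b ⟩ → (P ⨾ Q) ⊢ x ↦ z ⟨ 2 + (a + b) ⟩
  _⨾′_ {a = a} {b} (by (s , p , s≤)) (by (t , q , t≤)) = by (_ , seq p q , suc-+-≼ {a = a} {b} s≤ t≤)

  true!′ : ∀ {x} → true! ⊢ x ↦ nil ∙ nil ⟨ 2 ⟩
  true!′ = mknil′ ∙′ mknil′

  if-true′ : ∀ {P Q R x y u v a b} → P ⊢ x ↦ u ∙ v ⟨ a ⟩ → Q ⊢ x ↦ y ⟨ b ⟩ →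
             (if P then Q else R) ⊢ x ↦ y ⟨ 2 + (a + b) ⟩
  if-true′ {a = a} {b} (by (s , p , s≤)) (by (t , q , t≤)) = by (_ , if-true p q , suc-+-≼ {a = a} {b} s≤ t≤)

  if-false′ : ∀ {P Q R x y a b} → P ⊢ x ↦ nil ⟨ a ⟩ → R ⊢ x ↦ y ⟨ b ⟩ →
              (if P then Q else R) ⊢ x ↦ y ⟨ 2 + (a + b) ⟩
  if-false′ {a = a} {b} (by (s , p , s≤)) (by (t , q , t≤)) = by (_ , if-false p q , suc-+-≼ {a = a} {b} s≤ t≤)

  if′ : ∀ {P Q R x} {A : Set} {u v : A} {f : A → Tree} c {a b d} → P ⊢ x ↦ encodeBool c ⟨ a ⟩ →
        Q ⊢ x ↦ f u ⟨ b ⟩ → R ⊢ x ↦ f v ⟨ d ⟩ →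
        (if P then Q else R) ⊢ x ↦ f (ifᵇ c then u else v) ⟨ 2 + (a + (b + d)) ⟩
  if′ true  {a} {b} {d} p q r = weaken (+-monoʳ-≤ 2 (+-monoʳ-≤ a (m≤m+n b d))) (if-true′ p q)
  if′ false {a} {b} {d} p q r = weaken (+-monoʳ-≤ 2 (+-monoʳ-≤ a (m≤n+m d b))) (if-false′ p r)

  data Iterates (P Q : Program) (a b : ℕ) : ℕ → Tree → Tree → Set where
    stop : ∀ {x} → P ⊢ x ↦ nil ⟨ a ⟩ → Iterates P Q a b 0 x x
    step : ∀ {k x y z u v} → P ⊢ x ↦ u ∙ v ⟨ a ⟩ → Q ⊢ x ↦ y ⟨ b ⟩ →
           Iterates P Q a b k y z → Iterates P Q a b (suc k) x z

  -- The factor `suc k` counts the `k` rounds and the final failing test, each of which fits into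
  -- `N ^ (2 + (a + b))`.
  iterates-halts : ∀ {P Q a b k x z} → Iterates P Q a b k x z →
                   HaltsWithin (while P loop Q) x z (suc k * N ^ (2 + (a + b)))
  iterates-halts {a = a} {b} (stop (by (s , p , s≤))) =
    suc s , while-stop p ,
    ≤-trans (+-≼ {a = 0} {a} (1≼ 0) s≤)
      (≤-trans (^-monoʳ-≤ N (m≤n⇒m≤1+n (s≤s (m≤m+n a b)))) (m≤m+n _ 0))
  iterates-halts {a = a} {b} (step (by (s , p , s≤)) (by (t , q , t≤)) it) with iterates-halts it
  ... | r , w , r≤ = _ , while-step p q w , +-mono-≤ (suc-+-≼ {a = a} {b} s≤ t≤) r≤

  while′ : ∀ {P Q a b k e x z} → Iterates P Q a b k x z → k ≼ e →
           (while P loop Q) ⊢ x ↦ z ⟨ 3 + (e + (a + b)) ⟩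
  while′ {a = a} {b} {e = e} it k≼e with iterates-halts it
  ... | t , run , t≤ = by (t , run ,
    ≤-trans t≤ (≤-trans (*-≼ {a = suc e} {2 + (a + b)} (+-≼ {a = 0} {e} (1≼ 0) k≼e) ≤-refl)
      (^-monoʳ-≤ N (≤-reflexive (cong suc (trans (+-suc e _) (cong suc (+-suc e _))))))))

-- Correctness and running time of compiled expressions

toList-tabulate : ∀ {n} {A : Set} (f : Fin n → A) →
                  toList (tabulate f) ≡ foldr (λ i l → f i ∷ l) [] (allFin n)
toList-tabulate {n} f = go n (λ i → i)
  where
  go : ∀ k (g : Fin k → Fin n) →
       toList (tabulate (f ∘ g)) ≡ foldr (λ i l → f i ∷ l) [] (List.tabulate g)
  go zero    g = refl
  go (suc k) g = cong (f (g zero) ∷_) (go k (g ∘ suc))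

-- The only access of the algorithm to `μ`. One exponent serves all graphs and all `p`, so the
-- length of `p` does not enter the running time.
Tests : SetFunction → Program → ℕ → Set
Tests μ test a = ∀ {n} (G : Graph n) X p →
  HaltsWithin test (encodeGraph G ∙ encodeSubset X ∙ encodeℕ p)
                   (encodeBool (does (μ G X ≤? p))) ((2 ⊔ n) ^ a)

module Correctness {μ : SetFunction} {test : Program} {testDegree : ℕ} (test′ : Tests μ test testDegree)
                   (n : ℕ) where

  open Semantics μ
  open Compiler test testDegree
  open Timing (2 ⊔ n) (m≤m⊔n 2 n)

  n≼1 : n ≼ 1
  n≼1 = ≤-trans (m≤n⊔m 2 n) (≤-reflexive (sym (*-identityʳ _)))

  loop′ : ∀ {B : Set} {encB : B → Tree} (f : Fin n → B → B) {b₀ E ixs init step a b c} →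
          ixs ⊢ E ↦ indices n ⟨ a ⟩ → init ⊢ E ↦ encB b₀ ⟨ b ⟩ →
          (∀ i x → step ⊢ encB x ∙ encode index i ∙ E ↦ encB (f i x) ⟨ c ⟩) →
          loopP ixs init step ⊢ E ↦ encB (foldr f b₀ (allFin n)) ⟨ 36 + (a + (b + c)) ⟩
  loop′ {B} {encB} f {b₀} {E} {step = step′} {a} {b} {c} ixs init stp =
    weaken (≤-reflexive (bound a b c))
      (subst (λ x → _ ⊢ _ ↦ encB x ⟨ _ ⟩) (reverse-foldl _ _ (allFin n))
        (((ixs ∙′ init) ∙′ skip′) ⨾′ while′ {e = 1} (iterations _ b₀) count ⨾′ hd′ ⨾′ tl′))
    where
    State : List (Fin n) → B → Tree
    State is x = (encodeList (encode index) is ∙ encB x) ∙ E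

    -- The exponent 2 belongs to the test `hd ⨾ hd`, and 20 is the overhead of `loopBody` around one
    -- run of the step.
    iterations : ∀ is x → Iterates (hd ⨾ hd) (loopBody step′) 2 (20 + (c + 0)) (length is)
                            (State is x) (State [] (foldl (λ y i → f i y) x is))
    iterations []       x = stop (hd′ ⨾′ hd′)
    iterations (i ∷ is) x = step (hd′ ⨾′ hd′)
      (((hd′ ⨾′ hd′ ⨾′ tl′) ∙′ (((hd′ ⨾′ tl′) ∙′ ((hd′ ⨾′ hd′ ⨾′ hd′) ∙′ tl′)) ⨾′ stp i x)) ∙′ tl′)
      (iterations is (f i x))

    count : length (reverse (allFin n)) ≼ 1
    count = subst (_≼ 1) (sym (trans (length-reverse (allFin n)) (length-tabulate {n = n} (λ i → i)))) n≼1

    bound : ∀ a b c → 6 + (a + b + 0 + (2 + (26 + (c + 0) + 2))) ≡ 36 + (a + (b + c))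
    bound = solve-∀

  var′ : ∀ {Γ A} (x : A ∈ Γ) (γ : Env Γ n) →
         varP x ⊢ encodeEnv γ ↦ encode A (All.lookup γ x) ⟨ varDegree x ⟩
  var′ (here refl) (_ ∷ γ) = hd′
  var′ (there x)   (_ ∷ γ) = tl′ ⨾′ var′ x γ

  indices′ : ∀ {Γ} (γ : Env Γ n) → indicesP Γ ⊢ encodeEnv γ ↦ indices n ⟨ indicesDegree Γ ⟩
  indices′ []      = skip′
  indices′ (_ ∷ γ) = tl′ ⨾′ indices′ γ

  -- The loop strips both numbers in parallel and stops when either is exhausted, so a bound on `i`
  -- alone limits the rounds. Something of `j` is left exactly when `i < j`.
  less′ : ∀ i j → i ≤ n → lessP ⊢ encodeUnary i ∙ encodeUnary j ↦ encodeBool (i <ᵇ j) ⟨ 18 ⟩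
  less′ i j i≤n with iterations i j
    where
    iterations : ∀ i j → ∃ λ k → k ≤ i × ∃ λ u → ∃ λ v →
      Iterates (if hd then tl else mknil) (cons (hd ⨾ tl) (tl ⨾ tl)) 2 6 k
               (encodeUnary i ∙ encodeUnary j) (u ∙ v) ×
      (if tl then true! else mknil) ⊢ u ∙ v ↦ encodeBool (i <ᵇ j) ⟨ 4 ⟩
    iterations zero    zero    =
      0 , z≤n , _ , _ , stop (if-false′ hd′ mknil′) , weaken (m≤m+n 2 2) (if-false′ tl′ mknil′)
    iterations zero    (suc j) = 0 , z≤n , _ , _ , stop (if-false′ hd′ mknil′) , if-true′ tl′ true!′
    iterations (suc i) zero    =
      0 , z≤n , _ , _ , stop (if-true′ hd′ tl′) , weaken (m≤m+n 2 2) (if-false′ tl′ mknil′)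
    iterations (suc i) (suc j) with iterations i j
    ... | k , k≤i , u , v , it , res =
      suc k , s≤s k≤i , u , v ,
      step (if-true′ hd′ tl′) ((hd′ ⨾′ tl′) ∙′ (tl′ ⨾′ tl′)) it , res
  ... | k , k≤i , u , v , it , res = while′ {e = 1} it (≤-trans k≤i (≤-trans i≤n n≼1)) ⨾′ res

  at′ : ∀ {A k} (enc : A → Tree) (v : Vec A k) i → k ≤ n →
        atP ⊢ encodeList enc (toList v) ∙ encode index i ↦ enc (lookup v i) ⟨ 14 ⟩
  at′ enc v i k≤n with iterations v i
    where
    iterations : ∀ {k} v (i : Fin k) → ∃ λ w →
      Iterates tl (cons (hd ⨾ tl) (tl ⨾ tl)) 0 6 (toℕ i)
               (encodeList enc (toList v) ∙ encode index i) ((enc (lookup v i) ∙ w) ∙ nil)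
    iterations (x ∷ v) zero = _ , stop tl′
    iterations (x ∷ v) (suc i) with iterations v i
    ... | w , it = w , step tl′ ((hd′ ⨾′ tl′) ∙′ (tl′ ⨾′ tl′)) it
  ... | w , it = while′ {e = 1} it (≤-trans (<⇒≤ (toℕ<n i)) (≤-trans k≤n n≼1)) ⨾′ hd′ ⨾′ hd′

  mutual
    -- The exponent depends on the syntax alone: loops make `n` rounds, values are copied as
    -- pointers at unit cost, and unary numbers are changed or tested only at their head. `less` and
    -- `at` walk along an index, which is below `n`.
    compile′ : ∀ {Γ A} (e : Exp Γ A) (γ : Env Γ n) →
               compile e ⊢ encodeEnv γ ↦ encode A (⟦ e ⟧ γ) ⟨ degree e ⟩
    compile′ (var x)      γ = var′ x γ
    compile′ (‵let e b)   γ =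
      weaken (≤-reflexive (cong (λ d → 4 + (d + degree b)) (+-identityʳ _)))
        ((compile′ e γ ∙′ skip′) ⨾′ compile′ b (⟦ e ⟧ γ ∷ γ))
    compile′ (call as e)  γ = compile*′ as γ ⨾′ compile′ e _
    compile′ ‵true        γ = true!′
    compile′ ‵false       γ = mknil′
    compile′ {A = A} (c ‵? e ∶ f) γ = if′ {f = encode A} (⟦ c ⟧ γ) (compile′ c γ) (compile′ e γ) (compile′ f γ)
    compile′ (less e f)   γ = (compile′ e γ ∙′ compile′ f γ) ⨾′
                              less′ _ _ (<⇒≤ (toℕ<n (⟦ e ⟧ γ)))
    compile′ (at e f)     γ = (compile′ e γ ∙′ compile′ f γ) ⨾′ at′ _ (⟦ e ⟧ γ) (⟦ f ⟧ γ) ≤-refl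
    compile′ (tab {A} e)  γ = weaken (≤-reflexive (tabDegree _ (degree e)))
      -- A vector is a fold that conses onto the empty list, so the loop lemma for `iter` covers
      -- `tab` as well.
      (subst (λ l → compile (tab e) ⊢ encodeEnv γ ↦ encodeList (encode A) l ⟨ _ ⟩) (sym (toList-tabulate _))
        (loop′ {encB = encodeList (encode A)} _ (indices′ γ) mknil′
          λ i _ → (tl′ ⨾′ compile′ e (i ∷ γ)) ∙′ hd′))
    compile′ {A = A} (iter e b)   γ =
      loop′ {encB = encode A} _ (indices′ γ) (compile′ e γ) λ i a → compile′ b (a ∷ i ∷ γ)
    compile′ ‵zero        γ = mknil′
    compile′ (‵suc e)     γ = mknil′ ∙′ compile′ e γ
    compile′ (‵pred e)    γ with ⟦ e ⟧ γ | compile′ e γ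
    ... | zero  | p = weaken (≤-reflexive (cong (2 +_) (+-identityʳ _))) (p ⨾′ tl-nil′)
    ... | suc _ | p = weaken (≤-reflexive (cong (2 +_) (+-identityʳ _))) (p ⨾′ tl′)
    compile′ (isZero e)   γ with ⟦ e ⟧ γ | compile′ e γ
    ... | zero  | p = weaken (≤-reflexive (cong (2 +_) (+-comm (degree e) 2))) (if-false′ p true!′)
    ... | suc _ | p = weaken (≤-trans (≤-reflexive (cong (2 +_) (+-identityʳ _))) (m≤n+m _ 2)) (if-true′ p mknil′)
    compile′ ‵[]          γ = mknil′
    compile′ (e ‵∷ f)     γ = compile′ e γ ∙′ compile′ f γ
    compile′ ‵nothing     γ = mknil′
    compile′ (‵just e)    γ = weaken (≤-reflexive (cong (2 +_) (+-identityʳ _))) (compile′ e γ ∙′ mknil′)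
    compile′ (rows e)     γ = compile′ e γ
    compile′ (within e f g) γ = weaken (≤-reflexive (withinDegree (degree e) (degree f) (degree g) testDegree))
      ((compile′ e γ ∙′ compile′ f γ ∙′ compile′ g γ) ⨾′ by (test′ (⟦ e ⟧ γ) (⟦ f ⟧ γ) (⟦ g ⟧ γ)))

    compile*′ : ∀ {Γ Δ} (es : All (Exp Γ) Δ) (γ : Env Γ n) →
                compile* es ⊢ encodeEnv γ ↦ encodeEnv (⟦ es ⟧* γ) ⟨ degree* es ⟩
    compile*′ []       γ = indices′ γ
    compile*′ (e ∷ es) γ = compile′ e γ ∙′ compile*′ es γ

    tabDegree : ∀ x d → 36 + (x + (4 + (d + 0))) ≡ 40 + (x + d)
    tabDegree = solve-∀

    withinDegree : ∀ e f g t → 4 + (e + (2 + (f + g)) + t) ≡ 6 + (t + (e + (f + g)))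
    withinDegree = solve-∀

-- Testing μ G X ≤ p

height : Tree → ℕ
height nil     = 0
height (x ∙ y) = suc (height x ⊔ height y)

height≤size : ∀ x → height x ≤ size x
height≤size nil     = z≤n
height≤size (x ∙ y) = s≤s (⊔-lub (≤-trans (height≤size x) (m≤m+n _ _)) (≤-trans (height≤size y) (m≤n+m _ _)))

-- Although a program can double the size of a tree in one step, its height grows slowly.
height-output : ∀ {P x y t} → P ⊢ x ⇒ y [ t ] → height y ≤ height x + t
height-output skip     = m≤m+n _ 1
height-output mknil    = z≤n
height-output hd-nil   = z≤n
height-output hd-∙     = ≤-trans (m≤m⊔n _ _) (≤-trans (n≤1+n _) (m≤m+n _ 1))
height-output tl-nil   = z≤n
height-output (tl-∙ {x = x})     = ≤-trans (m≤n⊔m (height x) _) (≤-trans (n≤1+n _) (m≤m+n _ 1))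
height-output {x = x} (cons {s = s} {t = t} p q) = ≤-trans
  (s≤s (⊔-lub (≤-trans (height-output p) (+-monoʳ-≤ (height x) (m≤m+n s t)))
              (≤-trans (height-output q) (+-monoʳ-≤ (height x) (m≤n+m t s)))))
  (≤-reflexive (sym (+-suc _ _)))
height-output {x = x} (seq {y = y} {s = s} {t = t} p q) = begin
  _                       ≤⟨ height-output q ⟩
  height y + t            ≤⟨ +-monoˡ-≤ t (height-output p) ⟩
  height x + s + t        ≡⟨ +-assoc (height x) s t ⟩
  height x + (s + t)      ≤⟨ +-monoʳ-≤ (height x) (n≤1+n _) ⟩
  height x + suc (s + t)  ∎
  where open ≤-Reasoning
height-output {x = x} (if-true {s = s} {t = t} p q) =
  ≤-trans (height-output q) (+-monoʳ-≤ (height x) (m≤n+m t (suc s)))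
height-output {x = x} (if-false {s = s} {t = t} p q) =
  ≤-trans (height-output q) (+-monoʳ-≤ (height x) (m≤n+m t (suc s)))
height-output (while-stop p) = m≤m+n _ _
height-output {x = x} (while-step {s = s} {y = y} {t = t} {r = r} p q w) = begin
  _                           ≤⟨ height-output w ⟩
  height y + r                ≤⟨ +-monoˡ-≤ r (height-output q) ⟩
  height x + t + r            ≡⟨ +-assoc (height x) t r ⟩
  height x + (t + r)          ≤⟨ +-monoʳ-≤ (height x) (+-monoˡ-≤ r (m≤n+m t (suc s))) ⟩
  height x + (suc s + t + r)  ∎
  where open ≤-Reasoning

-- Comparison of numbers in bijective binary

digits : ℕᵇ → ℕ
digits 0ᵇ       = 0
digits 1+[2 k ] = suc (digits k)
digits 2[1+ k ] = suc (digits k)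

digits≤height : ∀ k → digits k ≤ height (encodeℕᵇ k)
digits≤height 0ᵇ       = z≤n
digits≤height 1+[2 k ] = s≤s (≤-trans (digits≤height k) (m≤n⊔m 0 _))
digits≤height 2[1+ k ] = s≤s (≤-trans (digits≤height k) (m≤n⊔m 1 _))

-- Compares x and y from the least significant digit on: r tells whether the digits
-- already read from x are at most those read from y, and so decides a tie.
leq : Bool → ℕᵇ → ℕᵇ → Bool
leq r 0ᵇ       0ᵇ       = r
leq r 0ᵇ       1+[2 _ ] = true
leq r 0ᵇ       2[1+ _ ] = true
leq r 1+[2 _ ] 0ᵇ       = false
leq r 2[1+ _ ] 0ᵇ       = false
leq r 1+[2 x ] 1+[2 y ] = leq r x y
leq r 1+[2 x ] 2[1+ y ] = leq true x y
leq r 2[1+ x ] 1+[2 y ] = leq false x y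
leq r 2[1+ x ] 2[1+ y ] = leq r x y

Below : Bool → ℕᵇ → ℕᵇ → Set
Below true  = B._≤_
Below false = B._<_

-- Since 1 + 2x < 2 + 2y iff x ≤ y, and 2 + 2x < 1 + 2y iff x < y, unequal digits reset the flag
-- whatever it was, while equal digits keep it.
leq-sound : ∀ r x y → leq r x y ≡ true → Below r x y
leq-sound true 0ᵇ 0ᵇ _ = inj₂ refl
leq-sound true 0ᵇ 1+[2 _ ] _ = inj₁ 0<odd
leq-sound true 0ᵇ 2[1+ _ ] _ = inj₁ 0<even
leq-sound false 0ᵇ 1+[2 _ ] _ = 0<odd
leq-sound false 0ᵇ 2[1+ _ ] _ = 0<even
leq-sound true 1+[2 x ] 1+[2 y ] e with leq-sound true x y e
... | inj₁ x<y = inj₁ (odd<odd x<y)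
... | inj₂ refl = inj₂ refl
leq-sound true 1+[2 x ] 2[1+ y ] e = inj₁ (odd<even (leq-sound true x y e))
leq-sound true 2[1+ x ] 1+[2 y ] e = inj₁ (even<odd (leq-sound false x y e))
leq-sound true 2[1+ x ] 2[1+ y ] e with leq-sound true x y e
... | inj₁ x<y = inj₁ (even<even x<y)
... | inj₂ refl = inj₂ refl
leq-sound false 1+[2 x ] 1+[2 y ] e = odd<odd (leq-sound false x y e)
leq-sound false 1+[2 x ] 2[1+ y ] e = odd<even (leq-sound true x y e)
leq-sound false 2[1+ x ] 1+[2 y ] e = even<odd (leq-sound false x y e)
leq-sound false 2[1+ x ] 2[1+ y ] e = even<even (leq-sound false x y e)

leq-complete : ∀ r x y → Below r x y → leq r x y ≡ true
leq-complete false _ _ 0<odd = refl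
leq-complete false _ _ 0<even = refl
leq-complete false _ _ (odd<odd x<y) = leq-complete false _ _ x<y
leq-complete false _ _ (odd<even x≤y) = leq-complete true _ _ x≤y
leq-complete false _ _ (even<odd x<y) = leq-complete false _ _ x<y
leq-complete false _ _ (even<even x<y) = leq-complete false _ _ x<y
leq-complete true _ _ (inj₁ 0<odd) = refl
leq-complete true _ _ (inj₁ 0<even) = refl
leq-complete true _ _ (inj₁ (odd<odd x<y)) = leq-complete true _ _ (inj₁ x<y)
leq-complete true _ _ (inj₁ (odd<even x≤y)) = leq-complete true _ _ x≤y
leq-complete true _ _ (inj₁ (even<odd x<y)) = leq-complete false _ _ x<y
leq-complete true _ _ (inj₁ (even<even x<y)) = leq-complete true _ _ (inj₁ x<y)
leq-complete true 0ᵇ _ (inj₂ refl) = refl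
leq-complete true 1+[2 x ] _ (inj₂ refl) = leq-complete true x x (inj₂ refl)
leq-complete true 2[1+ x ] _ (inj₂ refl) = leq-complete true x x (inj₂ refl)

leq-does : ∀ m p → leq true (fromℕ m) (fromℕ p) ≡ does (m ≤? p)
leq-does m p with leq true (fromℕ m) (fromℕ p) in eq
... | true  = sym (dec-true (m ≤? p) (B.fromℕ-cancel-≤ (leq-sound true _ _ eq)))
... | false = sym (dec-false (m ≤? p) λ m≤p →
  contradiction (trans (sym (leq-complete true _ _ (B.fromℕ-mono-≤ m≤p))) eq) λ ())

-- The state is (remaining digits of x ∙ remaining digits of y) ∙ r.
compareDigits : Program
compareDigits = cons (cons (hd ⨾ hd ⨾ tl) (hd ⨾ tl ⨾ tl))
  (if hd ⨾ hd ⨾ hd then (if hd ⨾ tl ⨾ hd then tl else mknil)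
                   else (if hd ⨾ tl ⨾ hd then true! else tl))

-- In bijective binary a number with more digits is larger, so a remainder on one side decides. The
-- flag matters only when both numbers end together; it starts as true because equality must count
-- as `≤`.
testP : Program → Program
testP M =
  cons (cons (cons hd (tl ⨾ hd) ⨾ M) (tl ⨾ tl)) true! ⨾
  (while (if hd ⨾ hd then hd ⨾ tl else mknil) loop compareDigits) ⨾
  (if hd ⨾ hd then mknil else if hd ⨾ tl then true! else tl)

-- One `a` pays for the run of `M`, the other for the number of comparison rounds, which is bounded
-- through the height of the output of `M`.
testDegree : ℕ → ℕ
testDegree a = 81 + 2 * a

module _ (N : ℕ) (2≤N : 2 ≤ N) where
  open Timing N 2≤N

  size-list : ∀ {A : Set} {enc : A → Tree} {n a} → n ≼ 1 → (∀ x → size (enc x) ≼ a) →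
              (v : Vec A n) → size (encodeList enc (toList v)) ≼ 3 + a
  size-list {enc = enc} {n} {a} n≼1 small v = ≤-trans (bound v)
    (+-≼ {a = 0} {2 + a} (1≼ 0) (*-≼ {a = 1} {1 + a} n≼1 (+-≼ {a = 0} {a} (1≼ 0) ≤-refl)))
    where
    bound : ∀ {k} (v : Vec _ k) → size (encodeList enc (toList v)) ≤ suc (k * suc (N ^ a))
    bound []      = ≤-refl
    bound (x ∷ v) = s≤s (≤-trans (+-mono-≤ (small x) (bound v)) (≤-reflexive (+-suc _ _)))

  -- The exponent is 3 for a boolean and grows by 3 with each level of lists: 6 for a subset, 9 for
  -- the matrix. Pairing the two gives 2 + 9 + 6.
  size-input : ∀ {n} → n ≼ 1 → (G : Graph n) (X : Subset n) →
               size (encodeGraph G ∙ encodeSubset X) ≼ 17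
  size-input n≼1 G X = suc-+-≼ {a = 9} {6}
      (size-list {a = 6} n≼1 (size-list {a = 3} n≼1 size-bool) (adjacency G))
      (size-list {a = 3} n≼1 size-bool X)
    where
    size-bool : ∀ b → size (encodeBool b) ≼ 3
    size-bool true  = const-≼ 3
    size-bool false = 1≼ 3

  weakenᵀ : ∀ {P x y a b} {a≤b : T (a ≤ᵇ b)} → P ⊢ x ↦ y ⟨ a ⟩ → P ⊢ x ↦ y ⟨ b ⟩
  weakenᵀ {a = a} {b} {a≤b} = weaken (≤ᵇ⇒≤ a b a≤b)

  rest : ∀ {u v X Y R} → cons (hd ⨾ hd ⨾ tl) (hd ⨾ tl ⨾ tl) ⊢ ((u ∙ X) ∙ (v ∙ Y)) ∙ R ↦ X ∙ Y ⟨ 10 ⟩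
  rest = (hd′ ⨾′ hd′ ⨾′ tl′) ∙′ (hd′ ⨾′ tl′ ⨾′ tl′)

  compare′ : ∀ r x y → ∃ λ k → k ≤ digits x × ∃ λ z →
    Iterates (if hd ⨾ hd then hd ⨾ tl else mknil) compareDigits 6 26 k
             ((encodeℕᵇ x ∙ encodeℕᵇ y) ∙ encodeBool r) z ×
    (if hd ⨾ hd then mknil else if hd ⨾ tl then true! else tl) ⊢ z ↦ encodeBool (leq r x y) ⟨ 10 ⟩
  compare′ r 0ᵇ 0ᵇ = _ , z≤n , _ , stop (weakenᵀ (if-false′ (hd′ ⨾′ hd′) mknil′)) ,
    weakenᵀ (if-false′ (hd′ ⨾′ hd′) (if-false′ (hd′ ⨾′ tl′) tl′))
  compare′ r 0ᵇ 1+[2 y ] = _ , z≤n , _ , stop (weakenᵀ (if-false′ (hd′ ⨾′ hd′) mknil′)) ,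
    weakenᵀ (if-false′ (hd′ ⨾′ hd′) (if-true′ (hd′ ⨾′ tl′) true!′))
  compare′ r 0ᵇ 2[1+ y ] = _ , z≤n , _ , stop (weakenᵀ (if-false′ (hd′ ⨾′ hd′) mknil′)) ,
    weakenᵀ (if-false′ (hd′ ⨾′ hd′) (if-true′ (hd′ ⨾′ tl′) true!′))
  compare′ r 1+[2 x ] 0ᵇ = _ , z≤n , _ , stop (if-true′ (hd′ ⨾′ hd′) (hd′ ⨾′ tl′)) ,
    weakenᵀ (if-true′ (hd′ ⨾′ hd′) mknil′)
  compare′ r 2[1+ x ] 0ᵇ = _ , z≤n , _ , stop (if-true′ (hd′ ⨾′ hd′) (hd′ ⨾′ tl′)) ,
    weakenᵀ (if-true′ (hd′ ⨾′ hd′) mknil′)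
  compare′ r 1+[2 x ] 1+[2 y ] with compare′ r x y
  ... | k , k≤ , z , it , res = _ , s≤s k≤ , z , step (if-true′ (hd′ ⨾′ hd′) (hd′ ⨾′ tl′))
    (rest ∙′ weakenᵀ (if-false′ {a = 4} (hd′ ⨾′ hd′ ⨾′ hd′) (if-false′ (hd′ ⨾′ tl′ ⨾′ hd′) tl′))) it , res
  compare′ r 1+[2 x ] 2[1+ y ] with compare′ true x y
  ... | k , k≤ , z , it , res = _ , s≤s k≤ , z , step (if-true′ (hd′ ⨾′ hd′) (hd′ ⨾′ tl′))
    (rest ∙′ if-false′ {a = 4} (hd′ ⨾′ hd′ ⨾′ hd′) (if-true′ (hd′ ⨾′ tl′ ⨾′ hd′) true!′)) it , res
  compare′ r 2[1+ x ] 1+[2 y ] with compare′ false x y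
  ... | k , k≤ , z , it , res = _ , s≤s k≤ , z , step (if-true′ (hd′ ⨾′ hd′) (hd′ ⨾′ tl′))
    (rest ∙′ weakenᵀ (if-true′ {a = 4} (hd′ ⨾′ hd′ ⨾′ hd′) (if-false′ (hd′ ⨾′ tl′ ⨾′ hd′) mknil′))) it , res
  compare′ r 2[1+ x ] 2[1+ y ] with compare′ r x y
  ... | k , k≤ , z , it , res = _ , s≤s k≤ , z , step (if-true′ (hd′ ⨾′ hd′) (hd′ ⨾′ tl′))
    (rest ∙′ weakenᵀ (if-true′ {a = 4} (hd′ ⨾′ hd′ ⨾′ hd′) (if-true′ (hd′ ⨾′ tl′ ⨾′ hd′) tl′))) it , res

  testP′ : ∀ {M a n} → n ≼ 1 → (G : Graph n) (X : Subset n) → ∀ m p →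
    M ⊢ encodeGraph G ∙ encodeSubset X ↦ encodeℕ m ⟨ a ⟩ →
    testP M ⊢ encodeGraph G ∙ encodeSubset X ∙ encodeℕ p ↦ encodeBool (does (m ≤? p)) ⟨ testDegree a ⟩
  testP′ {M} {a} n≼1 G X m p M′@(by (t , run , t≤)) with compare′ true (fromℕ m) (fromℕ p)
  ... | k , k≤ , z , it , res =
    weaken (≤-reflexive (total a))
      (subst (λ b → testP M ⊢ encodeGraph G ∙ encodeSubset X ∙ encodeℕ p ↦ encodeBool b ⟨ _ ⟩)
        (leq-does m p)
        ((((hd′ ∙′ (tl′ ⨾′ hd′)) ⨾′ M′) ∙′ (tl′ ⨾′ tl′)) ∙′ true!′ ⨾′ while′ {e = 18 + a} it few ⨾′ res))
    where
    total : ∀ a → 2 + (10 + (a + 2 + 2) + (2 + (3 + (18 + a + 32) + 10))) ≡ 81 + 2 * a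
    total = solve-∀

    -- The digits of `m` form a path in the output tree of `M`, so their number is at most the input
    -- height plus the running time.
    few : k ≼ 18 + a
    few = begin
      k                   ≤⟨ k≤ ⟩
      digits (fromℕ m)    ≤⟨ digits≤height (fromℕ m) ⟩
      height (encodeℕ m)  ≤⟨ height-output run ⟩
      height input + t    ≤⟨ +-mono-≤ (≤-trans (height≤size input) (size-input n≼1 G X)) t≤ ⟩
      N ^ 17 + N ^ a      ≤⟨ +-≼ {a = 17} {a} ≤-refl ≤-refl ⟩
      N ^ (18 + a)        ∎
      where
      open ≤-Reasoning
      input : Tree
      input = encodeGraph G ∙ encodeSubset X

tests : ∀ {μ : SetFunction} → ((M , _) : PolynomialTime μ) → ∃ (Tests μ (testP M))
tests {μ} (M , c , k , M-correct) = testDegree (c + 17 * k) , λ {n} G X p →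
  let open Timing (2 ⊔ n) (m≤m⊔n 2 n)
      n≼1 : n ≼ 1
      n≼1 = ≤-trans (m≤n⊔m 2 n) (≤-reflexive (sym (*-identityʳ _)))
      t , run , t≤ = M-correct G X
      -- The coefficient is absorbed by `c ≤ (2 ⊔ n) ^ c`, and the input size is at most
      -- `(2 ⊔ n) ^ 17`.
      polynomial : c * size (encodeGraph G ∙ encodeSubset X) ^ k ≼ c + 17 * k
      polynomial = *-≼ {a = c} {17 * k} (const-≼ c)
        (≤-trans (^-monoˡ-≤ k (size-input _ (m≤m⊔n 2 n) n≼1 G X)) (≤-reflexive (^-*-assoc (2 ⊔ n) 17 k)))
  in halts (testP′ (2 ⊔ n) (m≤m⊔n 2 n) {a = c + 17 * k} n≼1 G X (μ G X) p
       (by (t , run , ≤-trans t≤ polynomial)))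

-- The algorithm

pattern v₀ = here refl
pattern v₁ = there v₀
pattern v₂ = there v₁
pattern v₃ = there v₂
pattern v₄ = there v₃
pattern v₅ = there v₄
pattern v₆ = there v₅

subset matrix : Ty
subset = vec bool
matrix = vec subset

_‵∧_ : ∀ {Γ} → Exp Γ bool → Exp Γ bool → Exp Γ bool
e ‵∧ f = e ‵? f ∶ ‵false

same : ∀ {Γ} → Exp Γ index → Exp Γ index → Exp Γ bool
same i j = less i j ‵? ‵false ∶ (less j i ‵? ‵false ∶ ‵true)

cutSize : Exp (subset ∷ graph ∷ []) unary
cutSize = iter ‵zero (iter (var v₀)
  ((less u w ‵∧ (at (at (rows G) u) w ‵∧ (at X u ‵? (at X w ‵? ‵false ∶ ‵true) ∶ at X w)))
    ‵? ‵suc (var v₀) ∶ var v₀))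
  where
  w = var v₁
  u = var v₃
  X = var v₄
  G = var v₅

-- As `q` is fixed, the subtraction is unrolled into the program text and adds 2 per unit of `q` to
-- the degree. It is truncated, so the result is zero exactly when the argument is at most `q`.
minus : ∀ {Γ} → ℕ → Exp Γ unary → Exp Γ unary
minus zero    e = e
minus (suc q) e = minus q (‵pred e)

smallCut : ℕ → Exp (subset ∷ graph ∷ []) bool
smallCut q = isZero (minus q cutSize)

cluster : ℕ → Exp (subset ∷ graph ∷ number ∷ []) bool
cluster q = within (var v₁) (var v₀) (var v₂) ‵∧ call (var v₀ ∷ var v₁ ∷ []) (smallCut q)

grow : Exp (subset ∷ matrix ∷ []) subset
grow = tab (iter (at (var v₁) (var v₀))
  ((at (var v₃) (var v₁) ‵∧ at (at (var v₄) (var v₁)) (var v₂)) ‵? ‵true ∶ var v₀))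

component : Exp (index ∷ matrix ∷ []) subset
component = iter (tab (same (var v₀) (var v₁))) (call (var v₀ ∷ var v₃ ∷ []) grow)

clear : Exp (index ∷ index ∷ matrix ∷ []) matrix
clear = tab (tab
  ((same (var v₁) (var v₂) ‵∧ same (var v₀) (var v₃)) ‵? ‵false ∶
  ((same (var v₁) (var v₃) ‵∧ same (var v₀) (var v₂)) ‵? ‵false ∶
   at (at (var v₄) (var v₁)) (var v₀))))

-- A set that misses the vertex stands for failure, so the accumulator is its own success flag. The
-- recursion on `j` unfolds into nested loops over all ordered pairs. Each level clears exactly one
-- pair; pairs with equal ends are included and remove no edge, which accounts for sets of fewer
-- pairs.
search : ℕ → ℕ → Exp (index ∷ matrix ∷ graph ∷ number ∷ []) subset
search q zero    = ‵let (call (var v₀ ∷ var v₁ ∷ []) component)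
  (call (var v₀ ∷ var v₃ ∷ var v₄ ∷ []) (cluster q) ‵? var v₀ ∶ tab ‵false)
search q (suc j) = iter (tab ‵false) (iter (var v₀)
  (at (var v₀) (var v₄) ‵? var v₀ ∶
   call (var v₄ ∷ call (var v₃ ∷ var v₁ ∷ var v₅ ∷ []) clear ∷ var v₆ ∷ var (there v₆) ∷ [])
     (search q j)))

difference : Exp (subset ∷ subset ∷ []) subset
difference = tab (at (var v₂) (var v₀) ‵? ‵false ∶ at (var v₁) (var v₀))

put : Exp (index ∷ subset ∷ matrix ∷ []) matrix
put = tab (same (var v₀) (var v₁) ‵? var v₂ ∶ at (var v₃) (var v₀))

-- Only a cut is tested, because `μ` cannot increase on a subset. If the first difference fails,
-- posimodularity guarantees the second.
uncross : ℕ → Exp (matrix ∷ index ∷ index ∷ graph ∷ []) matrix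
uncross q =
  call (call (X ∷ Y ∷ []) difference ∷ var v₃ ∷ []) (smallCut q)
    ‵? call (var v₁ ∷ call (X ∷ Y ∷ []) difference ∷ var v₀ ∷ []) put
    ∶ call (var v₂ ∷ call (Y ∷ X ∷ []) difference ∷ var v₀ ∷ []) put
  where
  X = at (var v₀) (var v₁)
  Y = at (var v₀) (var v₂)

uncrossAll : ℕ → Exp (matrix ∷ graph ∷ []) matrix
uncrossAll q = iter (var v₀) (iter (var v₀)
  (less (var v₃) (var v₁) ‵? call (var v₀ ∷ var v₃ ∷ var v₁ ∷ var v₅ ∷ []) (uncross q) ∶ var v₀))

nonempty : Exp (subset ∷ []) bool
nonempty = iter ‵false (at (var v₂) (var v₁) ‵? ‵true ∶ var v₀)

-- Uncrossing may leave empty sets behind; they are dropped because the blocks of a partition are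
-- nonempty.
collect : Exp (matrix ∷ []) (list subset)
collect = iter ‵[] (call (at (var v₂) (var v₁) ∷ []) nonempty
  ‵? (at (var v₂) (var v₁) ‵∷ var v₀) ∶ var v₀)

findAll : ℕ → Exp (graph ∷ number ∷ []) matrix
findAll q = tab (call (var v₀ ∷ rows (var v₁) ∷ var v₁ ∷ var v₂ ∷ []) (search q q))

allFound : Exp (matrix ∷ []) bool
allFound = iter ‵true (at (at (var v₂) (var v₁)) (var v₁) ‵? var v₀ ∶ ‵false)

solve : ℕ → Exp (graph ∷ number ∷ []) (maybe (list subset))
solve q = ‵let (findAll q)
  (call (var v₀ ∷ []) allFound
    ‵? ‵just (call (call (var v₀ ∷ var v₁ ∷ []) (uncrossAll q) ∷ []) collect)
    ∶ ‵nothing)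

module _ (test : Program) (D : ℕ) where
  open Compiler test D

  degree-minus : ∀ {Γ} q (e : Exp Γ unary) → degree (minus q e) ≡ q * 2 + degree e
  degree-minus zero    e = refl
  degree-minus (suc q) e = trans (degree-minus q (‵pred e))
    (trans (sym (+-assoc (q * 2) 2 (degree e))) (cong (_+ degree e) (+-comm (q * 2) 2)))

  -- The numerals are the values to which degree normalises.
  degree-search : ∀ q j → degree (search q j) ≡ j * 666 + degree (search q zero)
  degree-search q zero    = refl
  degree-search q (suc j) = cong (666 +_) (degree-search q j)

  -- The slope 670 is 666 per guessed pair plus 2 for each of the two occurrences of `minus q`, one
  -- in `cluster` and one in `uncross`.
  degree-solve : ∀ q → degree (solve q) ≡ 2296 + (q * 670 + D)
  degree-solve q rewrite degree-search q q | degree-minus q cutSize = total q D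
    where
    total : ∀ q D → 72 + (q * 666 + (408 + (D + 6 + (18 + (q * 2 + 270 + 0)) + 50)) +
                          (444 + (q * 2 + 270 + 586 + 0 + 6 + 166 + 0)))
                    ≡ 2296 + (q * 670 + D)
    total = solve-∀

-- Correctness of the algorithm

∧⁻ : ∀ a {b} → (ifᵇ a then b else false) ≡ true → a ≡ true × b ≡ true
∧⁻ true eq = refl , eq

∧⁺ : ∀ {a b} → a ≡ true → b ≡ true → (ifᵇ a then b else false) ≡ true
∧⁺ refl eq = eq

∨⁻ : ∀ a {b} → (ifᵇ a then true else b) ≡ true → a ≡ true ⊎ b ≡ true
∨⁻ true  _  = inj₁ refl
∨⁻ false eq = inj₂ eq

∖⁻ : ∀ a {b} → (ifᵇ a then false else b) ≡ true → a ≡ false × b ≡ true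
∖⁻ false eq = refl , eq

∖⁺ : ∀ {a b} → a ≡ false → b ≡ true → (ifᵇ a then false else b) ≡ true
∖⁺ refl eq = eq

true≢false : ∀ {b} → b ≡ true → b ≡ false → ⊥
true≢false refl ()

≢true⇒≡false : ∀ {b} → ¬ b ≡ true → b ≡ false
≢true⇒≡false {true}  b≢true = contradiction refl b≢true
≢true⇒≡false {false} _      = refl

does⇒true : ∀ {P : Set} (P? : Dec P) → does P? ≡ true → P
does⇒true (yes p) _ = p

<ᵇ⁻ : ∀ {m n} → (m <ᵇ n) ≡ true → m < n
<ᵇ⁻ {m} {n} eq = <ᵇ⇒< m n (subst T (sym eq) tt)

<ᵇ⁺ : ∀ {m n} → m < n → (m <ᵇ n) ≡ true
<ᵇ⁺ {m} {n} = dec-true (m <? n)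

<ᵇ-irrefl : ∀ m → (m <ᵇ m) ≡ false
<ᵇ-irrefl m = dec-false (m <? m) (<-irrefl refl)

-- Written out so as to agree definitionally with the value of `same`.
sameᵇ : ∀ {n} → Fin n → Fin n → Bool
sameᵇ i j = ifᵇ toℕ i <ᵇ toℕ j then false else (ifᵇ toℕ j <ᵇ toℕ i then false else true)

same-refl : ∀ {n} (i : Fin n) → sameᵇ i i ≡ true
same-refl i rewrite <ᵇ-irrefl (toℕ i) = refl

same-sound : ∀ {n} (i j : Fin n) → sameᵇ i j ≡ true → i ≡ j
same-sound i j eq with ∖⁻ (toℕ i <ᵇ toℕ j) eq
... | i≮j , eq′ with ∖⁻ (toℕ j <ᵇ toℕ i) eq′
...   | j≮i , _ = toℕ-injective (≤-antisym
  (≮⇒≥ λ j<i → true≢false (<ᵇ⁺ j<i) j≮i) (≮⇒≥ λ i<j → true≢false (<ᵇ⁺ i<j) i≮j))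

infix 4 _∋_

_∋_ : ∀ {n} → Subset n → Fin n → Set
X ∋ v = lookup X v ≡ true

∋⇒∈ : ∀ {n} {X : Subset n} {v} → X ∋ v → v ∈ˢ X
∋⇒∈ {X = X} {v} = lookup⇒[]= v X

∈⇒∋ : ∀ {n} {X : Subset n} {v} → v ∈ˢ X → X ∋ v
∈⇒∋ = []=⇒lookup

does-∈ : ∀ {n} (v : Fin n) X → does (v ∈? X) ≡ lookup X v
does-∈ v X with lookup X v in eq
... | true  = dec-true (v ∈? X) (∋⇒∈ eq)
... | false = dec-false (v ∈? X) λ v∈X → true≢false (∈⇒∋ v∈X) eq

-- Folds as quantifiers, invariants and counters

any⁻ : ∀ {A : Set} (f : A → Bool) {b} xs →
       foldr (λ x a → ifᵇ f x then true else a) b xs ≡ true → b ≡ true ⊎ ∃ λ x → f x ≡ true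
any⁻ f []       eq = inj₁ eq
any⁻ f (x ∷ xs) eq with ∨⁻ (f x) eq
... | inj₁ fx  = inj₂ (x , fx)
... | inj₂ eq′ = any⁻ f xs eq′

any⁺ : ∀ {A : Set} (f : A → Bool) {b x xs} → x ∈ xs → f x ≡ true →
       foldr (λ x a → ifᵇ f x then true else a) b xs ≡ true
any⁺ f (here refl)        fx rewrite fx = refl
any⁺ f {xs = y ∷ _} (there x∈xs) fx with f y
... | true  = refl
... | false = any⁺ f x∈xs fx

any⁺-base : ∀ {A : Set} (f : A → Bool) {b} xs → b ≡ true →
            foldr (λ x a → ifᵇ f x then true else a) b xs ≡ true
any⁺-base f []       eq = eq
any⁺-base f (x ∷ xs) eq with f x
... | true  = refl
... | false = any⁺-base f xs eq

all⁻ : ∀ {A : Set} (f : A → Bool) {xs x} → foldr (λ x a → ifᵇ f x then a else false) true xs ≡ true →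
       x ∈ xs → f x ≡ true
all⁻ f {y ∷ _} eq (here refl)   = proj₁ (∧⁻ (f y) eq)
all⁻ f {y ∷ _} eq (there x∈xs) = all⁻ f (proj₂ (∧⁻ (f y) eq)) x∈xs

all-false⁻ : ∀ {A : Set} (f : A → Bool) xs → foldr (λ x a → ifᵇ f x then a else false) true xs ≡ false →
             ∃ λ x → f x ≡ false
all-false⁻ f (x ∷ xs) eq with f x in fx
... | true  = all-false⁻ f xs eq
... | false = x , fx

foldr-keeps : ∀ {A B : Set} {P : B → Set} {f : A → B → B} → (∀ x {b} → P b → P (f x b)) →
              ∀ {b} → P b → ∀ xs → P (foldr f b xs)
foldr-keeps keep Pb []       = Pb
foldr-keeps keep Pb (x ∷ xs) = keep x (foldr-keeps keep Pb xs)

foldr-reaches : ∀ {A B : Set} {P : B → Set} {f : A → B → B} → (∀ x {b} → P b → P (f x b)) →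
                ∀ {x} → (∀ b → P (f x b)) → ∀ {b xs} → x ∈ xs → P (foldr f b xs)
foldr-reaches keep reach (here refl)  = reach _
foldr-reaches keep reach (there x∈xs) = keep _ (foldr-reaches keep reach x∈xs)

-- Each element establishes its own goal when it is processed, and `old` ensures that the remaining
-- steps do not undo it.
foldr-achieves : ∀ {A B : Set} {P : B → Set} {Q : A → B → Set} {f : A → B → B} →
  (∀ x {b} → P b → P (f x b)) →
  (∀ x {b} → P b → Q x (f x b)) →
  (∀ x y {b} → P b → Q y b → Q y (f x b)) →
  ∀ {b} → P b → ∀ xs → P (foldr f b xs) × All (λ x → Q x (foldr f b xs)) xs
foldr-achieves keep new old Pb []       = Pb , []
foldr-achieves keep new old Pb (x ∷ xs) with foldr-achieves keep new old Pb xs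
... | Pb′ , Qs = keep x Pb′ , new x Pb′ ∷ All.map (old x _ Pb′) Qs

bit : Bool → ℕ
bit true  = 1
bit false = 0

tally : ∀ {A : Set} → (A → Bool) → List A → ℕ
tally b []       = 0
tally b (x ∷ xs) = bit (b x) + tally b xs

tally-cong : ∀ {A : Set} {b c : A → Bool} → (∀ x → b x ≡ c x) → ∀ xs → tally b xs ≡ tally c xs
tally-cong b≗c []       = refl
tally-cong b≗c (x ∷ xs) = cong₂ (λ y z → bit y + z) (b≗c x) (tally-cong b≗c xs)

tally-++ : ∀ {A : Set} (b : A → Bool) xs ys → tally b (xs ++ ys) ≡ tally b xs + tally b ys
tally-++ b []       ys = refl
tally-++ b (x ∷ xs) ys = trans (cong (bit (b x) +_) (tally-++ b xs ys)) (sym (+-assoc (bit (b x)) _ _))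

tally-map : ∀ {A B : Set} (b : B → Bool) (f : A → B) xs → tally b (map f xs) ≡ tally (b ∘ f) xs
tally-map b f []       = refl
tally-map b f (x ∷ xs) = cong (bit (b (f x)) +_) (tally-map b f xs)

length-filter-tally : ∀ {A : Set} {P : A → Set} (P? : Decidable P) xs →
                      length (filter P? xs) ≡ tally (does ∘ P?) xs
length-filter-tally P? []       = refl
length-filter-tally P? (x ∷ xs) with does (P? x)
... | true  = cong suc (length-filter-tally P? xs)
... | false = length-filter-tally P? xs

tally-filter : ∀ {A : Set} {P : A → Set} (P? : Decidable P) (b : A → Bool) xs →
               tally b (filter P? xs) ≡ tally (λ x → does (P? x) ∧ b x) xs
tally-filter P? b []       = refl
tally-filter P? b (x ∷ xs) with does (P? x)
... | true  = cong (bit (b x) +_) (tally-filter P? b xs)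
... | false = tally-filter P? b xs

foldr-tally : ∀ {A : Set} (b : A → Bool) a xs →
              foldr (λ x c → ifᵇ b x then suc c else c) a xs ≡ tally b xs + a
foldr-tally b a []       = refl
foldr-tally b a (x ∷ xs) with b x
... | true  = cong suc (foldr-tally b a xs)
... | false = foldr-tally b a xs

-- This is the shape of `cutSize`: the inner loop continues the count of the outer one, so the total
-- runs over the product from which `edges` is filtered.
foldr-tally² : ∀ {A B : Set} (b : A × B → Bool) xs ys →
  foldr (λ x c → foldr (λ y c′ → ifᵇ b (x , y) then suc c′ else c′) c ys) 0 xs
  ≡ tally b (cartesianProduct xs ys)
foldr-tally² b []       ys = refl
foldr-tally² b (x ∷ xs) ys = begin
  _                                                                ≡⟨ foldr-tally _ _ ys ⟩
  tally (λ y → b (x , y)) ys + _                                   ≡⟨ cong₂ _+_ (sym (tally-map b _ ys)) (foldr-tally² b xs ys) ⟩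
  tally b (map (x ,_) ys) + tally b (cartesianProduct xs ys)       ≡⟨ sym (tally-++ b (map (x ,_) ys) _) ⟩
  tally b (map (x ,_) ys ++ cartesianProduct xs ys)                ∎
  where open ≡-Reasoning

tally-mono : ∀ {A : Set} {b c : A → Bool} xs → (∀ {x} → x ∈ xs → b x ≡ true → c x ≡ true) →
             tally b xs ≤ tally c xs
tally-mono []       imp = z≤n
tally-mono {b = b} {c} (x ∷ xs) imp = +-mono-≤ (bit-mono (imp (here refl))) (tally-mono xs (imp ∘ there))
  where
  bit-mono : ∀ {y z} → (y ≡ true → z ≡ true) → bit y ≤ bit z
  bit-mono {false} _   = z≤n
  bit-mono {true}  imp rewrite imp refl = ≤-refl

tally-mono₂ : ∀ {A : Set} {b₁ b₂ c₁ c₂ : A → Bool} →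
  (∀ x → bit (b₁ x) + bit (b₂ x) ≤ bit (c₁ x) + bit (c₂ x)) →
  ∀ xs → tally b₁ xs + tally b₂ xs ≤ tally c₁ xs + tally c₂ xs
tally-mono₂ le []       = z≤n
tally-mono₂ {b₁ = b₁} {b₂} {c₁} {c₂} le (x ∷ xs) = begin
  (bit (b₁ x) + tally b₁ xs) + (bit (b₂ x) + tally b₂ xs)  ≡⟨ interchange (bit (b₁ x)) _ _ _ ⟩
  (bit (b₁ x) + bit (b₂ x)) + (tally b₁ xs + tally b₂ xs)  ≤⟨ +-mono-≤ (le x) (tally-mono₂ le xs) ⟩
  (bit (c₁ x) + bit (c₂ x)) + (tally c₁ xs + tally c₂ xs)  ≡⟨ interchange (bit (c₁ x)) _ _ _ ⟩
  (bit (c₁ x) + tally c₁ xs) + (bit (c₂ x) + tally c₂ xs)  ∎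
  where
  open ≤-Reasoning
  open import Algebra.Properties.CommutativeSemigroup +-commutativeSemigroup using (interchange)

-- Crossing edges, adjacency and subset sizes

crosses-does : ∀ {n} (X : Subset n) u v → does (crosses? X (u , v)) ≡ lookup X u xor lookup X v
crosses-does X u v rewrite does-∈ u X | does-∈ v X with lookup X u | lookup X v
... | true  | true  = refl
... | true  | false = refl
... | false | true  = refl
... | false | false = refl

crossing : ∀ {n} (X : Subset n) → Fin n × Fin n → Bool
crossing X (u , v) = lookup X u xor lookup X v

d-tally : ∀ {n} (G : Graph n) X → d G X ≡ tally (crossing X) (edges G)
d-tally G X = trans (length-filter-tally (crosses? X) (edges G))
  (tally-cong (λ (u , v) → crosses-does X u v) (edges G))

edge? : ∀ {n} (G : Graph n) (e : Fin n × Fin n) →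
        Dec (toℕ (proj₁ e) < toℕ (proj₂ e) × T (adj G (proj₁ e) (proj₂ e)))
edge? G (u , v) = (u <ᶠ? v) ×-dec T? (adj G u v)

∈-edges : ∀ {n} (G : Graph n) {u v} → toℕ u < toℕ v → adj G u v ≡ true → (u , v) ∈ edges G
∈-edges G u<v uv = ∈-filter⁺ _ (∈-cartesianProduct⁺ (∈-allFin _) (∈-allFin _)) (u<v , subst T (sym uv) tt)

edge-adj : ∀ {n} (G : Graph n) {u v} → (u , v) ∈ edges G → adj G u v ≡ true
edge-adj {n} G {u} {v} e with adj G u v | ∈-filter⁻ _ {xs = cartesianProduct (allFin n) (allFin n)} e
... | true | _ = refl

lookup-adjacency : ∀ {n} (G : Graph n) u v → lookup (lookup (adjacency G) u) v ≡ adj G u v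
lookup-adjacency G u v =
  trans (cong (λ r → lookup r v) (lookup∘tabulate _ u)) (lookup∘tabulate _ v)

⊆-dichotomy : ∀ {n} {X Y : Subset n} → X ⊆ˢ Y → X ≡ Y ⊎ ∣ X ∣ < ∣ Y ∣
⊆-dichotomy {X = []} {[]} _ = inj₁ refl
⊆-dichotomy {X = true ∷ X} {false ∷ Y} X⊆Y = contradiction (X⊆Y here) λ ()
⊆-dichotomy {X = false ∷ X} {true ∷ Y} X⊆Y = inj₂ (s≤s (p⊆q⇒∣p∣≤∣q∣ (drop-∷-⊆ X⊆Y)))
⊆-dichotomy {X = true ∷ X} {true ∷ Y} X⊆Y with ⊆-dichotomy (drop-∷-⊆ X⊆Y)
... | inj₁ refl = inj₁ refl
... | inj₂ lt   = inj₂ (s≤s lt)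
⊆-dichotomy {X = false ∷ X} {false ∷ Y} X⊆Y with ⊆-dichotomy (drop-∷-⊆ X⊆Y)
... | inj₁ refl = inj₁ refl
... | inj₂ lt   = inj₂ lt

module Solution (μ : SetFunction) (mono : Monotone μ) where
  open Semantics μ

  Arc : ∀ {n} → Vec (Subset n) n → Fin n → Fin n → Set
  Arc A x y = lookup A x ∋ y

  smallCut-≤ : ∀ q {n} (X : Subset n) (G : Graph n) → ⟦ smallCut q ⟧ (X ∷ G ∷ []) ≡ (d G X ∸ q ≡ᵇ 0)
  smallCut-≤ q {n} X G = cong (_≡ᵇ 0) (trans (minus-∸ q cutSize) (cong (_∸ q) count))
    where
    minus-∸ : ∀ q e → ⟦ minus q e ⟧ (X ∷ G ∷ []) ≡ ⟦ e ⟧ (X ∷ G ∷ []) ∸ q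
    minus-∸ zero    e = refl
    minus-∸ (suc q) e = trans (minus-∸ q (‵pred e)) (pred[m]∸n (⟦ e ⟧ (X ∷ G ∷ [])))
      where
      pred[m]∸n : ∀ m → pred m ∸ q ≡ m ∸ suc q
      pred[m]∸n zero    = 0∸n≡0 q
      pred[m]∸n (suc m) = refl

    test : Fin n × Fin n → Bool
    test (u , w) = ifᵇ toℕ u <ᵇ toℕ w then (ifᵇ lookup (lookup (adjacency G) u) w then
      (ifᵇ lookup X u then (ifᵇ lookup X w then false else true) else lookup X w) else false) else false

    test-correct : ∀ e → test e ≡ does (edge? G e) ∧ crossing X e
    test-correct (u , w) rewrite lookup-adjacency G u w with toℕ u <ᵇ toℕ w | adj G u w | lookup X u | lookup X w
    ... | false | _     | _     | _     = refl
    ... | true  | false | _     | _     = refl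
    ... | true  | true  | true  | true  = refl
    ... | true  | true  | true  | false = refl
    ... | true  | true  | false | _     = refl

    count : ⟦ cutSize ⟧ (X ∷ G ∷ []) ≡ d G X
    count = begin
      ⟦ cutSize ⟧ (X ∷ G ∷ [])                                   ≡⟨ foldr-tally² test (allFin n) (allFin n) ⟩
      tally test (cartesianProduct (allFin n) (allFin n))
        ≡⟨ tally-cong test-correct (cartesianProduct (allFin n) (allFin n)) ⟩
      tally (λ e → does (edge? G e) ∧ crossing X e) (cartesianProduct (allFin n) (allFin n))
        ≡⟨ sym (tally-filter (edge? G) (crossing X) (cartesianProduct (allFin n) (allFin n))) ⟩
      tally (crossing X) (edges G)                               ≡⟨ sym (d-tally G X) ⟩
      d G X                                                      ∎
      where open ≡-Reasoning

  smallCut⁻ : ∀ q {n} (X : Subset n) (G : Graph n) → ⟦ smallCut q ⟧ (X ∷ G ∷ []) ≡ true → d G X ≤ q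
  smallCut⁻ q X G eq = m∸n≡0⇒m≤n (≡ᵇ⇒≡ _ 0 (subst T (trans (sym eq) (smallCut-≤ q X G)) tt))

  smallCut⁺ : ∀ q {n} (X : Subset n) (G : Graph n) → d G X ≤ q → ⟦ smallCut q ⟧ (X ∷ G ∷ []) ≡ true
  smallCut⁺ q X G d≤q = trans (smallCut-≤ q X G) (cong (_≡ᵇ 0) (m≤n⇒m∸n≡0 d≤q))

  cluster⁻ : ∀ q {n} (X : Subset n) (G : Graph n) p → ⟦ cluster q ⟧ (X ∷ G ∷ p ∷ []) ≡ true →
             IsCluster μ p q G X
  cluster⁻ q X G p eq with ∧⁻ (does (μ G X ≤? p)) eq
  ... | small , cut = does⇒true (μ G X ≤? p) small , smallCut⁻ q X G cut

  cluster⁺ : ∀ q {n} (X : Subset n) (G : Graph n) p → IsCluster μ p q G X →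
             ⟦ cluster q ⟧ (X ∷ G ∷ p ∷ []) ≡ true
  cluster⁺ q X G p (small , cut) = ∧⁺ (dec-true (μ G X ≤? p) small) (smallCut⁺ q X G cut)

  -- Components by repeated growth

  module _ {n} (A : Vec (Subset n) n) where

    Grow : Subset n → Subset n
    Grow X = ⟦ grow ⟧ (X ∷ A ∷ [])

    reached : Subset n → Fin n → Fin n → Bool
    reached X y u = ifᵇ lookup X u then lookup (lookup A u) y else false

    lookup-Grow : ∀ X y → lookup (Grow X) y ≡
                  foldr (λ u a → ifᵇ reached X y u then true else a) (lookup X y) (allFin n)
    lookup-Grow X y = lookup∘tabulate _ y

    X⊆Grow : ∀ X → X ⊆ˢ Grow X
    X⊆Grow X {y} y∈X =
      ∋⇒∈ (trans (lookup-Grow X y) (any⁺-base (reached X y) (allFin n) (∈⇒∋ y∈X)))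

    Grow-arc : ∀ X {u y} → X ∋ u → Arc A u y → Grow X ∋ y
    Grow-arc X {u} {y} Xu uy = trans (lookup-Grow X y) (any⁺ (reached X y) (∈-allFin u) (∧⁺ Xu uy))

    Grow⁻ : ∀ X {y} → Grow X ∋ y → X ∋ y ⊎ ∃ λ u → X ∋ u × Arc A u y
    Grow⁻ X {y} Gy with any⁻ (reached X y) (allFin n) (trans (sym (lookup-Grow X y)) Gy)
    ... | inj₁ Xy      = inj₁ Xy
    ... | inj₂ (u , r) = inj₂ (u , ∧⁻ (lookup X u) r)

    Closed : Subset n → Set
    Closed X = ∀ {u y} → X ∋ u → Arc A u y → X ∋ y

    module _ (v : Fin n) where

      Component : Subset n
      Component = ⟦ component ⟧ (v ∷ A ∷ [])

      start : Subset n
      start = tabulate λ y → sameᵇ y v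

      reach : ∀ {B : Set} → List B → Subset n
      reach = foldr (λ _ → Grow) start

      start∋v : start ∋ v
      start∋v = trans (lookup∘tabulate _ v) (same-refl v)

      reach∋v : ∀ {B : Set} (is : List B) → reach is ∋ v
      reach∋v is = ∈⇒∋ (foldr-keeps {P = λ X → v ∈ˢ X} (λ _ {X} → X⊆Grow X) (∋⇒∈ start∋v) is)

      -- Until growth stabilises, every round adds a vertex to a set that starts with one. After `n`
      -- rounds the second alternative would need more than `n` vertices, so the component is
      -- closed.
      progress : ∀ {B : Set} (is : List B) → reach is ≡ Grow (reach is) ⊎ length is < ∣ reach is ∣
      progress []       = inj₂ (∣∣-positive {X = start} (∋⇒∈ start∋v))
        where
        ∣∣-positive : ∀ {n v} {X : Subset n} → v ∈ˢ X → 0 < ∣ X ∣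
        ∣∣-positive {v = v} {X} v∈X = subst (_≤ ∣ X ∣) (∣⁅x⁆∣≡1 v)
          (p⊆q⇒∣p∣≤∣q∣ λ x∈ → subst (_∈ˢ X) (sym (x∈⁅y⁆⇒x≡y v x∈)) v∈X)
      progress (_ ∷ is) with progress is
      ... | inj₁ fixed = inj₁ (cong Grow fixed)
      ... | inj₂ lt with ⊆-dichotomy (X⊆Grow (reach is))
      ...   | inj₁ fixed = inj₁ (cong Grow fixed)
      ...   | inj₂ lt′   = inj₂ (<-≤-trans (s≤s lt) lt′)

      Component∋v : Component ∋ v
      Component∋v = reach∋v (allFin n)

      Component-closed : Closed Component
      Component-closed {u} {y} Xu uy with progress (allFin n)
      ... | inj₁ fixed = subst (_∋ y) (sym fixed) (Grow-arc Component Xu uy)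
      ... | inj₂ lt    = contradiction (∣p∣≤n Component)
        (<⇒≱ (subst (_< ∣ Component ∣) (length-tabulate {n = n} (λ i → i)) lt))

      Component-least : ∀ {C} → C ∋ v → Closed C → ∀ {y} → Component ∋ y → C ∋ y
      Component-least {C} Cv closed = foldr-keeps {P = λ X → ∀ {y} → X ∋ y → C ∋ y}
        (λ _ {X} X⊆C Gy → [ X⊆C , (λ (u , Xu , uy) → closed (X⊆C Xu) uy) ]′ (Grow⁻ X Gy))
        (λ {y} sy → subst (C ∋_) (sym (same-sound y v (trans (sym (lookup∘tabulate _ y)) sy))) Cv)
        (allFin n)

  -- Deleting pairs of vertices

  clear₁ : ∀ {n} → Fin n × Fin n → Vec (Subset n) n → Vec (Subset n) n
  clear₁ (u , w) A = ⟦ clear ⟧ (u ∷ w ∷ A ∷ [])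

  module _ {n} (u w : Fin n) (A : Vec (Subset n) n) (x y : Fin n) where

    pair : Fin n → Fin n → Bool
    pair x y = ifᵇ sameᵇ x u then sameᵇ y w else false

    pair-sound : ∀ x y → pair x y ≡ true → (x , y) ≡ (u , w)
    pair-sound x y eq with ∧⁻ (sameᵇ x u) eq
    ... | xu , yw = cong₂ _,_ (same-sound x u xu) (same-sound y w yw)

    pair-refl : pair u w ≡ true
    pair-refl = ∧⁺ (same-refl u) (same-refl w)

    pair′ : Bool
    pair′ = ifᵇ sameᵇ x w then sameᵇ y u else false

    lookup-clear : lookup (lookup (clear₁ (u , w) A) x) y ≡
      (ifᵇ pair x y then false else (ifᵇ pair′ then false else lookup (lookup A x) y))
    lookup-clear = trans (cong (λ r → lookup r y) (lookup∘tabulate _ x)) (lookup∘tabulate _ y)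

    clear₁⁻ : Arc (clear₁ (u , w) A) x y → Arc A x y × (x , y) ≢ (u , w) × (y , x) ≢ (u , w)
    clear₁⁻ xy with ∖⁻ (pair x y) (trans (sym lookup-clear) xy)
    ... | no₁ , xy′ with ∖⁻ pair′ xy′
    ...   | no₂ , xy″ = xy″ ,
      (λ { refl → true≢false pair-refl no₁ }) ,
      (λ { refl → true≢false (∧⁺ (same-refl x) (same-refl y)) no₂ })

    clear₁⁺ : Arc A x y → Arc (clear₁ (u , w) A) x y ⊎ (x , y) ≡ (u , w) ⊎ (y , x) ≡ (u , w)
    clear₁⁺ xy with pair x y in eq | pair′ in eq′
    ... | true  | _    = inj₂ (inj₁ (pair-sound x y eq))
    ... | false | true with ∧⁻ (sameᵇ x w) eq′
    ...   | xw , yu = inj₂ (inj₂ (cong₂ _,_ (same-sound y u yu) (same-sound x w xw)))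
    clear₁⁺ xy | false | false = inj₁ (trans lookup-clear (∖⁺ eq (∖⁺ eq′ xy)))

  -- The head is cleared first, as in `search`, which clears a pair before it descends.
  clears : ∀ {n} → List (Fin n × Fin n) → Vec (Subset n) n → Vec (Subset n) n
  clears []       A = A
  clears (e ∷ es) A = clears es (clear₁ e A)

  clears⁻ : ∀ {n} es {A : Vec (Subset n) n} {x y} → Arc (clears es A) x y →
            Arc A x y × (x , y) ∉ es × (y , x) ∉ es
  clears⁻ []              xy = xy , (λ ()) , λ ()
  clears⁻ ((u , w) ∷ es) {A} {x} {y} xy with clears⁻ es xy
  ... | xy′ , ∉₁ , ∉₂ with clear₁⁻ u w A x y xy′
  ...   | xy″ , ≢₁ , ≢₂ = xy″ ,
    (λ { (here eq) → ≢₁ eq ; (there m) → ∉₁ m }) , (λ { (here eq) → ≢₂ eq ; (there m) → ∉₂ m })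

  clears⁺ : ∀ {n} es {A : Vec (Subset n) n} {x y} → Arc A x y →
            Arc (clears es A) x y ⊎ (x , y) ∈ es ⊎ (y , x) ∈ es
  clears⁺ []              xy = inj₁ xy
  clears⁺ ((u , w) ∷ es) {A} {x} {y} xy with clear₁⁺ u w A x y xy
  ... | inj₂ (inj₁ eq) = inj₂ (inj₁ (here eq))
  ... | inj₂ (inj₂ eq) = inj₂ (inj₂ (here eq))
  ... | inj₁ xy′ with clears⁺ es xy′
  ...   | inj₁ xy″       = inj₁ xy″
  ...   | inj₂ (inj₁ m) = inj₂ (inj₁ (there m))
  ...   | inj₂ (inj₂ m) = inj₂ (inj₂ (there m))

  -- The search for a cluster around a vertex

  module Search (q : ℕ) {n} (G : Graph n) (p : ℕ) (v : Fin n) where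

    Search : ℕ → Vec (Subset n) n → Subset n
    Search j A = ⟦ search q j ⟧ (v ∷ A ∷ G ∷ p ∷ [])

    Sound : Subset n → Set
    Sound X = X ∋ v → IsCluster μ p q G X

    ∅-sound : ∀ {X} → X ≡ tabulate (λ _ → false) → Sound X
    ∅-sound refl v∈∅ = ⊥-elim (true≢false v∈∅ (lookup∘tabulate _ v))

    Search-sound : ∀ j A → Sound (Search j A)
    Search-sound zero A with ⟦ cluster q ⟧ (Component A v ∷ G ∷ p ∷ []) in eq
    ... | true  = λ _ → cluster⁻ q (Component A v) G p eq
    ... | false = ∅-sound refl
    Search-sound (suc j) A =
      foldr-keeps {P = Sound}
        (λ u {X} sound → foldr-keeps {P = Sound} (λ w {Y} → try u w {Y}) sound (allFin n))
        (∅-sound refl) (allFin n)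
      where
      try : ∀ u w {Y} → Sound Y → Sound (ifᵇ lookup Y v then Y else Search j (clear₁ (u , w) A))
      try u w {Y} sound with lookup Y v
      ... | true  = λ _ → sound refl
      ... | false = Search-sound j (clear₁ (u , w) A)

    -- The set found may stem from other pairs than `es`. When the loops reach the head of `es`,
    -- either a success is already stored or this branch yields one, and by `keep` a success is
    -- never overwritten.
    Search-complete : ∀ es A → Search 0 (clears es A) ∋ v → Search (length es) A ∋ v
    Search-complete []             A found = found
    Search-complete ((u , w) ∷ es) A found =
      foldr-reaches {P = _∋ v} (λ u {X} f → foldr-keeps {P = _∋ v} (λ w {Y} → keep u w {Y}) f (allFin n))
        (λ X → foldr-reaches {P = _∋ v} (λ w {Y} → keep u w {Y}) (hit (Search-complete es _ found)) (∈-allFin w))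
        (∈-allFin u)
      where
      keep : ∀ u w {Y} → Y ∋ v →
             (ifᵇ lookup Y v then Y else Search (length es) (clear₁ (u , w) A)) ∋ v
      keep u w Yv rewrite Yv = Yv

      hit : ∀ {R} → R ∋ v → ∀ Y → (ifᵇ lookup Y v then Y else R) ∋ v
      hit Rv Y with lookup Y v in eq
      ... | true  = eq
      ... | false = Rv

    -- Deleting the edges that leave a cluster C around v (padded with the loop at v to
    -- exactly q pairs) leaves a component of v that lies inside C and whose boundary
    -- is part of that of C.
    module _ {C : Subset n} (v∈C : C ∋ v) (C-cluster : IsCluster μ p q G C) where

      boundary : List (Fin n × Fin n)
      boundary = filter (crosses? C) (edges G)

      deleted : List (Fin n × Fin n)
      deleted = boundary ++ replicate (q ∸ length boundary) (v , v)

      length-deleted : length deleted ≡ q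
      length-deleted = trans (length-++ boundary)
        (trans (cong (length boundary +_) (length-replicate (q ∸ length boundary)))
          (m+[n∸m]≡n (proj₂ C-cluster)))

      A : Vec (Subset n) n
      A = clears deleted (adjacency G)

      deleted⁻ : ∀ {x y} → adj G x y ≡ true → (x , y) ∈ deleted → crossing C (x , y) ≡ true
      deleted⁻ {x} {y} xy m with ∈-++⁻ boundary m
      ... | inj₁ b = trans (sym (crosses-does C x y))
        (dec-true (crosses? C _) (proj₂ (∈-filter⁻ (crosses? C) {xs = edges G} b)))
      -- A padding pair cannot be adjacent, since the graph is loopless.
      ... | inj₂ r with All.lookup (All.replicate⁺ {P = _≡ (v , v)} (q ∸ length boundary) refl) r
      ...   | refl = ⊥-elim (true≢false xy (loopless G v))

      crossing-swap : ∀ x y → crossing C (x , y) ≡ crossing C (y , x)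
      crossing-swap x y with lookup C x | lookup C y
      ... | true  | true  = refl
      ... | true  | false = refl
      ... | false | true  = refl
      ... | false | false = refl

      deleted⁺ : ∀ {x y} → toℕ x < toℕ y → adj G x y ≡ true → crossing C (x , y) ≡ true → (x , y) ∈ deleted
      deleted⁺ {x} {y} x<y xy cr = ∈-++⁺ˡ (∈-filter⁺ (crosses? C) (∈-edges G x<y xy)
        (does⇒true (crosses? C _) (trans (crosses-does C x y) cr)))

      -- An arc from `C` to its complement would be a crossing edge. That edge is listed in
      -- `deleted` with its smaller end first, whereas a surviving arc is listed in neither
      -- orientation.
      C-closed : Closed A C
      C-closed {u} {y} Cu uy with lookup C y in Cy
      ... | true  = refl
      ... | false with clears⁻ deleted uy
      ...   | uy′ , ∉₁ , ∉₂ with <-cmp (toℕ u) (toℕ y)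
      ...     | tri< u<y _ _ = contradiction (deleted⁺ u<y edge crosses) ∉₁
        where
        edge : adj G u y ≡ true
        edge = trans (sym (lookup-adjacency G u y)) uy′
        crosses : crossing C (u , y) ≡ true
        crosses rewrite Cu | Cy = refl
      ...     | tri> _ _ y<u = contradiction (deleted⁺ y<u edge crosses) ∉₂
        where
        edge : adj G y u ≡ true
        edge = trans (symmetric G y u) (trans (sym (lookup-adjacency G u y)) uy′)
        crosses : crossing C (y , u) ≡ true
        crosses rewrite Cu | Cy = refl
      ...     | tri≈ _ u≈y _ with toℕ-injective u≈y
      ...       | refl = ⊥-elim (true≢false Cu Cy)

      X : Subset n
      X = Component A v

      -- The edge cannot have survived the deletion, because `X` is closed under the surviving arcs;
      -- hence it is one of the deleted pairs.
      leaves : ∀ {x y} → adj G x y ≡ true → X ∋ x → lookup X y ≡ false → crossing C (x , y) ≡ true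
      leaves {x} {y} xy Xx Xy with clears⁺ deleted (trans (lookup-adjacency G x y) xy)
      ... | inj₁ arc      = ⊥-elim (true≢false (Component-closed A v Xx arc) Xy)
      ... | inj₂ (inj₁ m) = deleted⁻ xy m
      ... | inj₂ (inj₂ m) = trans (crossing-swap x y) (deleted⁻ (trans (symmetric G y x) xy) m)

      boundary-shrinks : ∀ {e} → e ∈ edges G → crossing X e ≡ true → crossing C e ≡ true
      boundary-shrinks {x , y} e cr with lookup X x in Xx | lookup X y in Xy
      ... | true  | false = leaves (edge-adj G e) Xx Xy
      ... | false | true  = trans (crossing-swap x y)
        (leaves (trans (symmetric G y x) (edge-adj G e)) Xy Xx)

      X-cluster : IsCluster μ p q G X
      X-cluster =
        ≤-trans (mono G λ x∈X → ∋⇒∈ (Component-least A v {C} v∈C C-closed (∈⇒∋ x∈X))) (proj₁ C-cluster) ,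
        ≤-trans (subst₂ _≤_ (sym (d-tally G X)) (sym (d-tally G C)) (tally-mono (edges G) boundary-shrinks))
          (proj₂ C-cluster)

      Search-finds : Search q (adjacency G) ∋ v
      Search-finds = subst (λ j → Search j (adjacency G) ∋ v) length-deleted
        (Search-complete deleted (adjacency G) found)
        where
        found : Search 0 A ∋ v
        found rewrite cluster⁺ q X G p X-cluster = Component∋v A v

  -- Posimodularity and uncrossing

  _∖_ : ∀ {n} → Subset n → Subset n → Subset n
  X ∖ Y = ⟦ difference ⟧ (X ∷ Y ∷ [])

  lookup-∖ : ∀ {n} (X Y : Subset n) x → lookup (X ∖ Y) x ≡ (ifᵇ lookup Y x then false else lookup X x)
  lookup-∖ X Y = lookup∘tabulate _

  ∖-sound : ∀ {n} (X Y : Subset n) {x} → X ∖ Y ∋ x → lookup Y x ≡ false × X ∋ x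
  ∖-sound X Y {x} eq = ∖⁻ (lookup Y x) (trans (sym (lookup-∖ X Y x)) eq)

  -- The inequality holds edge by edge, by the sixteen positions of the two ends relative to `X` and
  -- `Y`. It is strict only for edges between the intersection and the complement of the union.
  d-posimodular : ∀ {n} (G : Graph n) X Y → d G (X ∖ Y) + d G (Y ∖ X) ≤ d G X + d G Y
  d-posimodular G X Y = subst₂ _≤_
    (cong₂ _+_ (sym (d-tally G (X ∖ Y))) (sym (d-tally G (Y ∖ X))))
    (cong₂ _+_ (sym (d-tally G X)) (sym (d-tally G Y)))
    (tally-mono₂ edgewise (edges G))
    where
    edgewise : ∀ e → bit (crossing (X ∖ Y) e) + bit (crossing (Y ∖ X) e) ≤ bit (crossing X e) + bit (crossing Y e)
    edgewise (u , v) rewrite lookup-∖ X Y u | lookup-∖ X Y v | lookup-∖ Y X u | lookup-∖ Y X v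
      with lookup X u | lookup Y u | lookup X v | lookup Y v
    ... | true  | true  | true  | true  = z≤n
    ... | true  | true  | true  | false = s≤s z≤n
    ... | true  | true  | false | true  = s≤s z≤n
    ... | true  | true  | false | false = z≤n
    ... | true  | false | true  | true  = s≤s z≤n
    ... | true  | false | true  | false = z≤n
    ... | true  | false | false | true  = ≤-refl
    ... | true  | false | false | false = ≤-refl
    ... | false | true  | true  | true  = ≤-refl
    ... | false | true  | true  | false = ≤-refl
    ... | false | true  | false | true  = z≤n
    ... | false | true  | false | false = ≤-refl
    ... | false | false | true  | true  = z≤n
    ... | false | false | true  | false = ≤-refl
    ... | false | false | false | true  = ≤-refl
    ... | false | false | false | false = z≤n

  module Uncross (q : ℕ) {n} (G : Graph n) (p : ℕ) where

    Family : Set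
    Family = Vec (Subset n) n

    -- The covering index is existential because shrinking may take from set k the very vertex k for
    -- which it was found.
    Covers : Family → Set
    Covers F = ∀ v → ∃ λ k → lookup F k ∋ v

    Clusters : Family → Set
    Clusters F = ∀ k → IsCluster μ p q G (lookup F k)

    Good : Family → Set
    Good F = Clusters F × Covers F

    Disjoint : Fin n → Fin n → Family → Set
    Disjoint i j F = ∀ {x} → lookup F i ∋ x → lookup F j ∋ x → ⊥

    Put : Fin n → Subset n → Family → Family
    Put i D F = ⟦ put ⟧ (i ∷ D ∷ F ∷ [])

    lookup-Put : ∀ i D F k → lookup (Put i D F) k ≡ (ifᵇ sameᵇ k i then D else lookup F k)
    lookup-Put i D F = lookup∘tabulate _

    Put-hit : ∀ i D F → lookup (Put i D F) i ≡ D
    Put-hit i D F = trans (lookup-Put i D F i) (cong (ifᵇ_then D else lookup F i) (same-refl i))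

    Put-miss : ∀ i D F {k} → k ≢ i → lookup (Put i D F) k ≡ lookup F k
    Put-miss i D F {k} k≢i = trans (lookup-Put i D F k)
      (cong (ifᵇ_then D else lookup F k) (≢true⇒≡false (k≢i ∘ same-sound k i)))

    Shrink : Fin n → Fin n → Family → Family
    Shrink i j F = Put i (lookup F i ∖ lookup F j) F

    module _ {i j : Fin n} (i≢j : i ≢ j) (F : Family) where

      Shrink-⊆ : ∀ k {x} → lookup (Shrink i j F) k ∋ x → lookup F k ∋ x
      Shrink-⊆ k {x} m with sameᵇ k i in eq
      ... | true with same-sound k i eq
      ...   | refl = proj₂ (∖-sound (lookup F i) (lookup F j) (subst (_∋ x) (Put-hit i _ F) m))
      Shrink-⊆ k {x} m | false = subst (_∋ x)
        (trans (lookup-Put i _ F k) (cong (ifᵇ_then _ else lookup F k) eq)) m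

      Shrink-disjoint : Disjoint i j (Shrink i j F)
      Shrink-disjoint {x} mi mj = true≢false (subst (_∋ x) (Put-miss i _ F (i≢j ∘ sym)) mj)
        (proj₁ (∖-sound (lookup F i) (lookup F j) (subst (_∋ x) (Put-hit i _ F) mi)))

      Shrink-good : d G (lookup F i ∖ lookup F j) ≤ q → Good F → Good (Shrink i j F)
      Shrink-good cut (clusters , covers) = clusters′ , covers′
        where
        clusters′ : Clusters (Shrink i j F)
        clusters′ k with sameᵇ k i in eq
        ... | true with same-sound k i eq
        ...   | refl = subst (IsCluster μ p q G) (sym (Put-hit i _ F))
          (≤-trans (mono G λ m → ∋⇒∈ (proj₂ (∖-sound (lookup F i) (lookup F j) (∈⇒∋ m)))) (proj₁ (clusters i)) , cut)
        clusters′ k | false = subst (IsCluster μ p q G)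
          (sym (trans (lookup-Put i _ F k) (cong (ifᵇ_then _ else lookup F k) eq))) (clusters k)

        covers′ : Covers (Shrink i j F)
        covers′ v with covers v
        -- A vertex of set `j` stays covered by it, as only set `i` changes; any other vertex of set
        -- `i` survives in the difference.
        ... | k , kv with lookup (lookup F j) v in jv
        ...   | true  = j , subst (_∋ v) (sym (Put-miss i _ F (i≢j ∘ sym))) jv
        ...   | false with sameᵇ k i in eq
        ...     | false = k , subst (_∋ v)
          (sym (trans (lookup-Put i _ F k) (cong (ifᵇ_then _ else lookup F k) eq))) kv
        ...     | true with same-sound k i eq
        ...       | refl = i , subst (_∋ v) (sym (Put-hit i _ F))
          (trans (lookup-∖ (lookup F i) (lookup F j) v) (∖⁺ jv kv))

    Uncross : Fin n → Fin n → Family → Family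
    Uncross i j F = ⟦ uncross q ⟧ (F ∷ i ∷ j ∷ G ∷ [])

    module _ {i j : Fin n} (i≢j : i ≢ j) (F : Family) where

      Uncross-⊆ : ∀ k {x} → lookup (Uncross i j F) k ∋ x → lookup F k ∋ x
      Uncross-⊆ k with ⟦ smallCut q ⟧ ((lookup F i ∖ lookup F j) ∷ G ∷ [])
      ... | true  = Shrink-⊆ i≢j F k
      ... | false = Shrink-⊆ (i≢j ∘ sym) F k

      Uncross-disjoint : Disjoint i j (Uncross i j F)
      Uncross-disjoint with ⟦ smallCut q ⟧ ((lookup F i ∖ lookup F j) ∷ G ∷ [])
      ... | true  = Shrink-disjoint i≢j F
      ... | false = λ mi mj → Shrink-disjoint (i≢j ∘ sym) F mj mi

      Uncross-good : Good F → Good (Uncross i j F)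
      Uncross-good good@(clusters , _) with ⟦ smallCut q ⟧ ((lookup F i ∖ lookup F j) ∷ G ∷ []) in eq
      ... | true  = Shrink-good i≢j F (smallCut⁻ q _ G eq) good
      ... | false = Shrink-good (i≢j ∘ sym) F (≮⇒≥ impossible) good
        where
        X Y : Subset n
        X = lookup F i
        Y = lookup F j

        large : q < d G (X ∖ Y)
        large = ≰⇒> λ small → true≢false (smallCut⁺ q _ G small) eq

        impossible : ¬ q < d G (Y ∖ X)
        impossible large′ = <⇒≱ (+-mono-< large large′)
          (≤-trans (d-posimodular G X Y) (+-mono-≤ (proj₂ (clusters i)) (proj₂ (clusters j))))

    step : Fin n → Fin n → Family → Family
    step i j F = ifᵇ toℕ i <ᵇ toℕ j then Uncross i j F else F

    <⇒≢ᶠ : ∀ {i j : Fin n} → toℕ i < toℕ j → i ≢ j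
    <⇒≢ᶠ i<j refl = <-irrefl refl i<j

    step-⊆ : ∀ i j F k {x} → lookup (step i j F) k ∋ x → lookup F k ∋ x
    step-⊆ i j F k with toℕ i <ᵇ toℕ j in eq
    ... | true  = Uncross-⊆ (<⇒≢ᶠ (<ᵇ⁻ eq)) F k
    ... | false = λ m → m

    step-good : ∀ i j F → Good F → Good (step i j F)
    step-good i j F with toℕ i <ᵇ toℕ j in eq
    ... | true  = Uncross-good (<⇒≢ᶠ (<ᵇ⁻ eq)) F
    ... | false = λ good → good

    Separated : Fin n → Fin n → Family → Set
    Separated i j F = toℕ i < toℕ j → Disjoint i j F

    step-separates : ∀ i j F → Separated i j (step i j F)
    step-separates i j F i<j rewrite <ᵇ⁺ i<j = Uncross-disjoint (<⇒≢ᶠ i<j) F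

    -- Sets only shrink, so disjointness persists once it is reached; this is why a single pass over
    -- the pairs suffices.
    step-keeps : ∀ i j k l F → Separated k l F → Separated k l (step i j F)
    step-keeps i j k l F separated k<l mk ml =
      separated k<l (step-⊆ i j F k mk) (step-⊆ i j F l ml)

    row : Fin n → Family → Family
    row i F = foldr (step i) F (allFin n)

    row-good : ∀ i F → Good F → Good (row i F)
    row-good i F good = foldr-keeps {P = Good} (λ j {F} → step-good i j F) good (allFin n)

    row-separates : ∀ i F j → Separated i j (row i F)
    row-separates i F j = All.lookup (proj₂ (foldr-achieves {P = λ _ → ⊤} {Q = Separated i} {f = step i}
      (λ _ _ → tt) (λ j {F} _ → step-separates i j F) (λ k j {F} _ → step-keeps i k i j F) tt (allFin n)))
      (∈-allFin j)

    row-keeps : ∀ i k F → (∀ l → Separated k l F) → ∀ l → Separated k l (row i F)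
    row-keeps i k F separated l =
      foldr-keeps {P = Separated k l} (λ j {F} → step-keeps i j k l F) (separated l) (allFin n)

    UncrossAll : Family → Family
    UncrossAll F = ⟦ uncrossAll q ⟧ (F ∷ G ∷ [])

    UncrossAll-correct : ∀ F → Good F → Good (UncrossAll F) × ∀ i j → Separated i j (UncrossAll F)
    UncrossAll-correct F good
      with foldr-achieves {P = Good} {Q = λ i F → ∀ j → Separated i j F} {f = row}
             (λ i {F} → row-good i F) (λ i {F} _ → row-separates i F) (λ i k {F} _ → row-keeps i k F)
             good (allFin n)
    ... | good′ , separated = good′ , λ i → All.lookup separated (∈-allFin i)

    -- The partition extracted from a disjoint cover

    Collect : Family → List (Subset n)
    Collect F = ⟦ collect ⟧ (F ∷ [])

    module _ (F : Family) where

      occupied : Fin n → Bool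
      occupied i = ⟦ nonempty ⟧ (lookup F i ∷ [])

      sets : List (Fin n) → List (Subset n)
      sets = foldr (λ i Cs → ifᵇ occupied i then lookup F i ∷ Cs else Cs) []

      occupied⁻ : ∀ i → occupied i ≡ true → Nonempty (lookup F i)
      occupied⁻ i eq with any⁻ (lookup (lookup F i)) (allFin n) eq
      ... | inj₂ (v , m) = v , ∋⇒∈ m

      sets-all : ∀ {P : Subset n → Set} → (∀ i → occupied i ≡ true → P (lookup F i)) → ∀ is → All P (sets is)
      sets-all {P} all = foldr-keeps {P = All P} (λ i {Cs} → keep i {Cs}) []
        where
        keep : ∀ i {Cs} → All P Cs → All P (ifᵇ occupied i then lookup F i ∷ Cs else Cs)
        keep i Ps with occupied i in eq
        ... | true  = all i eq ∷ Ps
        ... | false = Ps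

      sets-allPairs : ∀ {R : Subset n → Subset n → Set} {is} →
                      AllPairs (λ i j → R (lookup F i) (lookup F j)) is → AllPairs R (sets is)
      sets-allPairs {is = []}     []         = []
      sets-allPairs {R} {i ∷ is} (Ri ∷ Rs) with occupied i
      ... | true  = heads is Ri ∷ sets-allPairs Rs
        where
        heads : ∀ js → All (λ j → R (lookup F i) (lookup F j)) js → All (R (lookup F i)) (sets js)
        heads []       []        = []
        heads (j ∷ js) (Rj ∷ Rjs) with occupied j
        ... | true  = Rj ∷ heads js Rjs
        ... | false = heads js Rjs
      ... | false = sets-allPairs Rs

      sets-covers : ∀ {v k is} → k ∈ is → lookup F k ∋ v → Any (v ∈ˢ_) (sets is)
      sets-covers {v} {k} (here refl) m rewrite any⁺ (lookup (lookup F k)) {b = false} (∈-allFin v) m = here (∋⇒∈ m)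
      sets-covers {is = i ∷ _} (there k∈is) m with occupied i
      ... | true  = there (sets-covers k∈is m)
      ... | false = sets-covers k∈is m

    Collect-correct : ∀ F → Good F → (∀ i j → Separated i j F) → IsClusterPartition μ p q G (Collect F)
    Collect-correct F (clusters , covers) separated =
      record
        { nonempty = sets-all F (occupied⁻ F) (allFin n)
        -- `allFin` is ascending, so the pairs to be checked are exactly those with `i < j`, for
        -- which `Separated` applies.
        ; disjoint = sets-allPairs F (tabulate⁺-< λ {i} {j} i<j (x , m) →
            let mi , mj = x∈p∩q⁻ (lookup F i) (lookup F j) m in separated i j i<j (∈⇒∋ mi) (∈⇒∋ mj))
        ; covering = λ v → let k , m = covers v in sets-covers F (∈-allFin k) m
        } ,
      sets-all F (λ i _ → clusters i) (allFin n)

  solve-correct : ∀ q {n} (G : Graph n) p → Solves μ p q G (⟦ solve q ⟧ (G ∷ p ∷ []))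
  solve-correct q {n} G p with ⟦ allFound ⟧ (⟦ findAll q ⟧ (G ∷ p ∷ []) ∷ []) in eq
  ... | true  = let good , separated = UncrossAll-correct found found-good in
                Collect-correct (UncrossAll found) good separated
    where
    open Uncross q G p
    open Search q G p

    found : Family
    found = ⟦ findAll q ⟧ (G ∷ p ∷ [])

    contains : ∀ v → lookup found v ∋ v
    contains v = all⁻ (λ v → lookup (lookup found v) v) eq (∈-allFin v)

    found-good : Good found
    found-good =
      (λ v → subst (IsCluster μ p q G) (sym (lookup∘tabulate _ v))
        (Search-sound v q (adjacency G) (subst (_∋ v) (lookup∘tabulate _ v) (contains v)))) ,
      λ v → v , contains v
  -- Some vertex was left without a set, but its block in a given partition would be a cluster
  -- around it, which the search cannot miss.
  ... | false = λ (Cs , partition , clusters) →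
    let v , missing = all-false⁻ (λ v → lookup (lookup (⟦ findAll q ⟧ (G ∷ p ∷ [])) v) v) (allFin n) eq
        C , C∈Cs , v∈C = find (IsPartition.covering partition v)
    in true≢false
         (subst (_∋ v) (sym (lookup∘tabulate _ v))
           (Search.Search-finds q G p v (∈⇒∋ v∈C) (All.lookup clusters C∈Cs)))
         missing

-- Running time of the algorithm

descending : ℕ → Tree
descending k = encodeList encodeUnary (downFrom k)

descending-indices : ∀ n → descending n ≡ indices n
descending-indices n = begin
  encodeList encodeUnary (downFrom n)                          ≡⟨ cong (encodeList encodeUnary) (sym (reverse-upTo n)) ⟩
  encodeList encodeUnary (reverse (upTo n))                    ≡⟨ cong (encodeList encodeUnary ∘ reverse) (tabulate-upTo n id) ⟩
  encodeList encodeUnary (reverse (List.tabulate {n = n} toℕ))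
    ≡⟨ cong (encodeList encodeUnary ∘ reverse) (sym (map-tabulate {n = n} id toℕ)) ⟩
  encodeList encodeUnary (reverse (map toℕ (allFin n)))        ≡⟨ cong (encodeList encodeUnary) (sym (reverse-map toℕ (allFin n))) ⟩
  encodeList encodeUnary (map toℕ (reverse (allFin n)))        ≡⟨ encodeList-map (reverse (allFin n)) ⟩
  indices n                                                    ∎
  where
  open ≡-Reasoning

  tabulate-upTo : ∀ k (f : ℕ → ℕ) → applyUpTo f k ≡ List.tabulate {n = k} (f ∘ toℕ)
  tabulate-upTo zero    f = refl
  tabulate-upTo (suc k) f = cong (f 0 ∷_) (tabulate-upTo k (f ∘ suc))

  encodeList-map : ∀ is → encodeList encodeUnary (map toℕ is) ≡ encodeList (encode index {n}) is
  encodeList-map []       = refl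
  encodeList-map (i ∷ is) = cong (encodeUnary (toℕ i) ∙_) (encodeList-map is)

-- The state is (remaining rows ∙ (k ∙ list of the numbers below k)).
countRow : Program
countRow = cons (hd ⨾ tl) (cons (cons mknil (tl ⨾ hd)) (cons (tl ⨾ hd) (tl ⨾ tl)))

rowIndices : Program
rowIndices = cons hd (cons mknil mknil) ⨾ (while hd loop countRow) ⨾ tl ⨾ tl

-- The index list at the end of the environment is not part of the input; it is produced by counting
-- the rows of the adjacency matrix.
prologue : Program
prologue = cons hd (cons tl rowIndices)

module _ (n : ℕ) where
  open Timing (2 ⊔ n) (m≤m⊔n 2 n)

  countRows′ : ∀ {A : Set} {enc : A → Tree} {m} (v : Vec A m) k → ∃ λ l →
    Iterates hd countRow 0 16 m (encodeList enc (toList v) ∙ encodeUnary k ∙ descending k)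
                                (nil ∙ l ∙ descending (m + k))
  countRows′ []      k = _ , stop hd′
  countRows′ {enc = enc} {suc m} (x ∷ v) k with countRows′ {enc = enc} v (suc k)
  ... | l , it = l , step hd′
    ((hd′ ⨾′ tl′) ∙′ (mknil′ ∙′ (tl′ ⨾′ hd′)) ∙′ (tl′ ⨾′ hd′) ∙′ (tl′ ⨾′ tl′))
    (subst (λ j → Iterates hd countRow 0 16 m (encodeList enc (toList v) ∙ encodeUnary (suc k) ∙ descending (suc k))
                                              (nil ∙ l ∙ descending j)) (+-suc m k) it)

  prologue′ : (G : Graph n) (p : ℕ) →
    prologue ⊢ encodeGraph G ∙ encodeℕ p ↦ encodeEnv {graph ∷ number ∷ []} (G ∷ p ∷ []) ⟨ 34 ⟩
  prologue′ G p with countRows′ {enc = encodeSubset} (adjacency G) 0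
  ... | l , it = hd′ ∙′ tl′ ∙′
    subst (λ x → rowIndices ⊢ encodeGraph G ∙ encodeℕ p ↦ x ⟨ 30 ⟩)
      (trans (cong descending (+-identityʳ n)) (descending-indices n))
      ((hd′ ∙′ (mknil′ ∙′ mknil′)) ⨾′
        while′ {e = 1} it (≤-trans (m≤n⊔m 2 n) (≤-reflexive (sym (*-identityʳ _)))) ⨾′ tl′ ⨾′ tl′)

-- The constant is 2296 from `degree-solve`, 34 for the prologue and 2 for the sequencing.
solverDegree : ℕ → ℕ → ℕ
solverDegree D q = 2332 + (q * 670 + D)

solverDegree-linear : ∀ D → IsLinear (solverDegree D)
-- From `q = 1` on, each constant is at most its product with `q`, so the coefficient is the sum of
-- all constants and the slope.
solverDegree-linear D = 2332 + (670 + D) , 1 , λ q 1≤q →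
  let instance q≢0 = >-nonZero 1≤q in begin
  2332 + (q * 670 + D)
    ≤⟨ +-mono-≤ (m≤m*n 2332 q) (+-mono-≤ (≤-reflexive (*-comm q 670)) (m≤m*n D q)) ⟩
  2332 * q + (670 * q + D * q)  ≡⟨ cong (2332 * q +_) (*-distribʳ-+ q 670 D) ⟨
  2332 * q + (670 + D) * q      ≡⟨ *-distribʳ-+ q 2332 (670 + D) ⟨
  (2332 + (670 + D)) * q        ∎
  where open ≤-Reasoning

module _ {μ : SetFunction} (mono : Monotone μ) {test : Program} {D : ℕ} (test′ : Tests μ test D) where
  open Compiler test D
  open Semantics μ
  open Solution μ mono

  solver-correct : ∀ q → SolvesInTime μ q (prologue ⨾ compile (solve q))
                           (λ n m → (2 ⊔ n) ^ solverDegree D q * (1 ⊔ m))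
  solver-correct q {n} G p = ⟦ solve q ⟧ (G ∷ p ∷ []) , bounded , solve-correct q G p
    where
    open Timing (2 ⊔ n) (m≤m⊔n 2 n)
    open Correctness {μ} {test} {D} test′ n

    run : (prologue ⨾ compile (solve q)) ⊢ encodeGraph G ∙ encodeℕ p ↦
            encodeAnswer (⟦ solve q ⟧ (G ∷ p ∷ [])) ⟨ solverDegree D q ⟩
    run = weaken (≤-reflexive (cong (36 +_) (degree-solve test D q)))
      (prologue′ n G p ⨾′ compile′ (solve q) (G ∷ p ∷ []))

    bounded : HaltsWithin (prologue ⨾ compile (solve q)) (encodeGraph G ∙ encodeℕ p)
                (encodeAnswer (⟦ solve q ⟧ (G ∷ p ∷ []))) ((2 ⊔ n) ^ solverDegree D q * (1 ⊔ #edges G))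
    bounded =
      let t , r , t≤ = halts run
      in t , r , ≤-trans t≤ (m≤m*n _ (1 ⊔ #edges G) {{>-nonZero (m≤m⊔n 1 (#edges G))}})

theorem2 : (μ : SetFunction) → Monotone μ → PolynomialTime μ →
    Σ (ℕ → ℕ) λ f → IsLinear f ×
    (∀ q → Σ Program λ A → SolvesInTime μ q A (λ n m → (2 ⊔ n) ^ f q * (1 ⊔ m)))
theorem2 μ mono poly =
  let D , test′ = tests {μ} poly
  in solverDegree D , solverDegree-linear D , λ q → _ , solver-correct {μ} mono {D = D} test′ q
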